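{- Assume the Browkin-Brzezinski conjecture: for every integer $n>2$ and every $\epsilon>0$ there exists a constant $C_{n,\epsilon}$ such that for all integers $a_1,\dots,a_n$ with $a_1+\cdots+a_n=0$, with no proper nonempty subset of the $a_i$ having zero sum, and with $\gcd(a_1,\dots,a_n)=1$, one has $$\max(|a_1|,\dots,|a_n|)\le C_{n,\epsilon}\,\bigl(\mathrm{rad}(a_1\cdots a_n)\bigr)^{2n-5+\epsilon}.$$ Then there exist infinitely many pairs of distinct primes $p_1$ and $p_2$ such that the ring $\mathbb{Z}\left[\frac{1}{p_1},\frac{1}{p_2}\right]$ does not have a 4-cycle.
   Context: For a nonzero integer $N$, $\mathrm{rad}(N)$ is the product of the distinct prime factors of $N$. For a ring $R$ and $f\in R[x]$, a 4-cycle of $f$ is a sequence $(x_1,x_2,x_3,x_4)$ of four distinct elements of $R$ with $f(x_1)=x_2$, $f(x_2)=x_3$, $f(x_3)=x_4$, $f(x_4)=x_1$. The ring $R$ has a 4-cycle if some polynomial $f\in R[x]$ has a 4-cycle in $R$. -}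

module Defs where

open import Algebra.Bundles using (CommutativeRing)
open import Algebra.Bundles.Raw using (RawRing)
open import Algebra.Morphism.Structures using (IsRingMonomorphism)
import Algebra.Morphism.RingMonomorphism as RingMonomorphism
import Algebra.Properties.CommutativeMonoid.Sum as Sum
open import Data.Bool using (if_then_else_)
open import Data.Fin.Subset using (Subset; Nonempty; _⊂_; ⊤)
open import Data.Integer as ℤ using (ℤ; +_; 0ℤ; 1ℤ; ∣_∣)
import Data.Integer.GCD as ℤ
import Data.Integer.Properties as ℤ
open import Data.List using (List; []; _∷_; filter; upTo)
open import Data.List.Membership.Propositional using (_∉_)
import Data.List.Relation.Unary.Unique.Setoid as UniqueSetoid
open import Data.Nat as ℕ using (ℕ; suc; NonZero)
open import Data.Nat.Divisibility using (_∣?_)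
import Data.Nat.ListAction as ℕ using (product)
open import Data.Nat.Primality using (prime?)
open import Data.Product using (Σ; _×_; _,_; proj₁; ∃-syntax)
open import Data.Rational as ℚ using (ℚ; 0ℚ; 1ℚ; ↥_; ↧ₙ_)
import Data.Rational.Properties as ℚ
open import Data.Sum using (_⊎_)
open import Data.Vec using (lookup)
open import Data.Vec.Functional using (Vector; foldr; map)
open import Function using (_on_; id)
open import Level using (Level; 0ℓ)
open import Relation.Binary.PropositionalEquality using (_≡_; _≢_; refl)
open import Relation.Nullary.Decidable using (_×-dec_)
open import Relation.Unary using (Pred)

private
  variable
    a c ℓ : Level

open Sum ℤ.+-0-commutativeMonoid using (sum)
open Sum ℤ.*-1-commutativeMonoid using () renaming (sum to product)

-- Meaningful for nonzero N only (rad 0ℤ evaluates to 1).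
rad : ℤ → ℕ
rad N = ℕ.product
  (filter (λ p → prime? p ×-dec (p ∣? ∣ N ∣)) (upTo (suc ∣ N ∣)))

gcd : ∀ {n} → Vector ℤ n → ℤ
gcd = foldr ℤ.gcd 0ℤ

max∣_∣ : ∀ {n} → Vector ℤ n → ℕ
max∣ v ∣ = foldr ℕ._⊔_ 0 (map ∣_∣ v)

sumOver : ∀ {n} → Subset n → Vector ℤ n → ℤ
sumOver S v = sum (λ i → if lookup S i then v i else 0ℤ)

-- The real inequality m ≤ C · r ^ e for a rational exponent e = s / t ≥ 0,
-- raised to the power t so that both sides are natural numbers.
_≤_·_^^_ : ℕ → ℕ → ℕ → ℚ → Set
m ≤ C · r ^^ e = m ℕ.^ (↧ₙ e) ℕ.≤ C ℕ.^ (↧ₙ e) ℕ.* r ℕ.^ ∣ ↥ e ∣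

-- It is enough to let ε be rational and C a natural number: rad ≥ 1, so the
-- bound for ε implies the bound for every larger real exponent, and a real
-- constant may be rounded up.  Each v i is nonzero by the subsum condition
-- for singletons, so rad is only applied to nonzero integers.
BrowkinBrzezinskiConjecture : Set
BrowkinBrzezinskiConjecture =
  ∀ (n : ℕ) → n ℕ.> 2 → ∀ (ε : ℚ) → ε ℚ.> 0ℚ →
  ∃[ C ] ∀ (v : Vector ℤ n) →
    sum v ≡ 0ℤ →
    (∀ (S : Subset n) → Nonempty S → S ⊂ ⊤ → sumOver S v ≢ 0ℤ) →
    gcd v ≡ 1ℤ →
    max∣ v ∣ ≤ C · rad (product v) ^^ ((+ (2 ℕ.* n) ℤ.- + 5) ℚ./ 1 ℚ.+ ε)

module _ (R : CommutativeRing c ℓ) where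
  open CommutativeRing R
  open UniqueSetoid setoid using (Unique)

  -- The list a₀ ∷ a₁ ∷ … stands for the polynomial a₀ + a₁ x + ….
  Polynomial : Set c
  Polynomial = List Carrier

  eval : Polynomial → Carrier → Carrier
  eval []       x = 0#
  eval (a₀ ∷ f) x = a₀ + x * eval f x

  record Is4Cycle (f : Polynomial) (x₁ x₂ x₃ x₄ : Carrier) : Set (c Level.⊔ ℓ) where
    field
      distinct : Unique (x₁ ∷ x₂ ∷ x₃ ∷ x₄ ∷ [])
      f[x₁]≈x₂ : eval f x₁ ≈ x₂
      f[x₂]≈x₃ : eval f x₂ ≈ x₃
      f[x₃]≈x₄ : eval f x₃ ≈ x₄
      f[x₄]≈x₁ : eval f x₄ ≈ x₁

  Has4Cycle : Set (c Level.⊔ ℓ)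
  Has4Cycle = ∃[ f ] ∃[ x₁ ] ∃[ x₂ ] ∃[ x₃ ] ∃[ x₄ ] Is4Cycle f x₁ x₂ x₃ x₄

-- The smallest subring of ℚ containing G.
data ℤ[_] (G : Pred ℚ 0ℓ) : Pred ℚ 0ℓ where
  gen  : ∀ {x} → G x → ℤ[ G ] x
  zero : ℤ[ G ] 0ℚ
  one  : ℤ[ G ] 1ℚ
  add  : ∀ {x y} → ℤ[ G ] x → ℤ[ G ] y → ℤ[ G ] (x ℚ.+ y)
  mul  : ∀ {x y} → ℤ[ G ] x → ℤ[ G ] y → ℤ[ G ] (x ℚ.* y)
  neg  : ∀ {x} → ℤ[ G ] x → ℤ[ G ] (ℚ.- x)

-- Elements are compared as rationals; membership proofs are irrelevant.
adjoinRawRing : Pred ℚ 0ℓ → RawRing 0ℓ 0ℓ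
adjoinRawRing G = record
  { Carrier = Σ ℚ ℤ[ G ]
  ; _≈_     = _≡_ on proj₁
  ; _+_     = λ (x , x∈) (y , y∈) → x ℚ.+ y , add x∈ y∈
  ; _*_     = λ (x , x∈) (y , y∈) → x ℚ.* y , mul x∈ y∈
  ; -_      = λ (x , x∈) → ℚ.- x , neg x∈
  ; 0#      = 0ℚ , zero
  ; 1#      = 1ℚ , one
  }

adjoin-isRingMonomorphism : ∀ G →
  IsRingMonomorphism (adjoinRawRing G) ℚ.+-*-rawRing proj₁
adjoin-isRingMonomorphism G = record
  { isRingHomomorphism = record
    { isSemiringHomomorphism = record
      { isNearSemiringHomomorphism = record
        { +-isMonoidHomomorphism = record
          { isMagmaHomomorphism = record
            { isRelHomomorphism = record { cong = id }
            ; homo = λ _ _ → refl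
            }
          ; ε-homo = refl
          }
        ; *-homo = λ _ _ → refl
        }
      ; 1#-homo = refl
      }
    ; -‿homo = λ _ → refl
    }
  ; injective = id
  }

adjoin : Pred ℚ 0ℓ → CommutativeRing 0ℓ 0ℓ
adjoin G = record
  { RawRing (adjoinRawRing G)
  ; isCommutativeRing = RingMonomorphism.isCommutativeRing
      (adjoin-isRingMonomorphism G) ℚ.+-*-isCommutativeRing
  }

ℤ[1/_,1/_] : (p q : ℕ) .{{_ : NonZero p}} .{{_ : NonZero q}} →
             CommutativeRing 0ℓ 0ℓ
ℤ[1/ p ,1/ q ] = adjoin (λ x → x ≡ 1ℤ ℚ./ p ⊎ x ≡ 1ℤ ℚ./ q)

-- No finite list exhausts P.
Infinite : {A : Set a} → Pred A ℓ → Set (a Level.⊔ ℓ)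
Infinite P = ∀ xs → ∃[ x ] (P x × x ∉ xs)

-- The differences of consecutive points of a 4-cycle in ℤ[1/p,1/q] divide one
-- another, so after scaling they are integers v₀, …, v₃ with sum zero, gcd 1 and
-- no prime factors other than p and q.  No subsum vanishes: for v₀ + v₁ and
-- v₁ + v₂ because the points are distinct, and for v₀ + v₂ by a parity argument,
-- since the former two sums are associated.  The conjecture with n = 4, ε = 1
-- then gives ∣ vᵢ ∣ ≤ C (p q)⁴.
--
-- If p, q ∈ (L , L²] with C ≤ L, the exponents of p are at most 16.  The terms
-- prime to q are of the form ± pˣ, and their sum is divisible by q.  There are
-- boundedly many sums of four elements of {0} ∪ {± pˣ : x ≤ 16}, each of size
-- polynomial in L, so if (L , L²] contains enough primes, some prime q in it
-- divides none of the nonzero ones.  For such a q the sum of the terms prime to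
-- q is zero, so all terms are prime to q; the same argument modulo p > 4 makes
-- all terms prime to p.  Hence vᵢ = ± 1, and some pair sums to zero.
--
-- Intervals (L , L²] with many primes are found by distributing the B distinct
-- prime factors of Gödel's numbers 1 + i B! over the intervals
-- (B ^ 2ʲ , B ^ 2ʲ⁺¹].

module Submission where

open import Defs
open import Algebra.Bundles using (CommutativeRing)
import Algebra.Properties.CommutativeMonoid.Sum as Sum
open import Data.Bool using (true; false; if_then_else_)
open import Data.Fin as Fin using (Fin; toℕ)
open import Data.Fin.Patterns using (0F; 1F; 2F; 3F)
import Data.Fin.Properties as Fin
open import Data.Fin.Subset as Subset using (Subset; Nonempty; _⊂_; ⊤; inside; outside)
import Data.Fin.Subset.Properties as Subset
open import Data.Integer as ℤ using (ℤ; +_; -[1+_]; 0ℤ; 1ℤ; ∣_∣)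
import Data.Integer.Divisibility.Signed as ℤ
open import Data.Integer.DivMod using (a≡a%n+[a/n]*n; n%d<d)
import Data.Integer.GCD as ℤ
import Data.Integer.Properties as ℤ
import Data.Integer.Tactic.RingSolver as ℤ-Solver
open import Data.List as List using (List; []; _∷_; _++_; length; filter; upTo; cartesianProductWith)
open import Data.List.Extrema.Nat using (max; xs≤max)
open import Data.List.Membership.Propositional using (_∈_; _∉_)
import Data.List.Membership.Propositional.Properties as ∈
import Data.List.Properties as List
open import Data.List.Relation.Unary.All as All using (All; []; _∷_)
import Data.List.Relation.Unary.All.Properties as All
open import Data.List.Relation.Unary.AllPairs using ([]; _∷_)
open import Data.List.Relation.Unary.Any as Any using (here; there)
import Data.List.Relation.Unary.Any.Properties as Any
open import Data.List.Relation.Unary.Unique.Propositional using (Unique)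
import Data.List.Relation.Unary.Unique.Propositional.Properties as Unique
open import Data.Nat as ℕ using (ℕ; zero; suc; _+_; _*_; _^_; _⊔_; _≤_; _<_; z≤n; s≤s; NonZero; _!)
open import Data.Nat.Coprimality using (Coprime; coprime-divisor)
open import Data.Nat.Divisibility
open import Data.Nat.GCD as ℕ using (c*gcd[m,n]≡gcd[cm,cn])
open import Data.Nat.ListAction using (product)
open import Data.Nat.ListAction.Properties using (∈⇒∣product; product≢0)
open import Data.Nat.Primality
open import Data.Nat.Primality.Factorisation using (factorise; factorisationHasAllPrimeFactors)
open import Data.Nat.Properties
import Data.Nat.Tactic.RingSolver as ℕ-Solver
open import Data.Product using (Σ; _×_; _,_; proj₁; proj₂; ∃; ∃-syntax; Σ-syntax)
open import Data.Rational as ℚ using (ℚ)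
import Data.Rational.Properties as ℚ
open import Data.Rational.Solver using (module +-*-Solver)
import Data.Rational.Unnormalised as ℚᵘ
import Data.Rational.Unnormalised.Properties as ℚᵘ
open import Data.Sum as Sum⊎ using (_⊎_; inj₁; inj₂)
open import Data.Vec using ([]; _∷_; lookup; tabulate)
open import Data.Vec.Properties as Vec using (lookup∘tabulate)
open import Data.Vec.Functional using (Vector)
open import Function using (_∘_; case_of_)
open import Level using (0ℓ)
open import Relation.Binary.Definitions using (tri<; tri≈; tri>)
open import Relation.Binary.PropositionalEquality hiding (J)
open import Relation.Nullary using (¬_; yes; no; does; contradiction)
open import Relation.Nullary.Decidable using (_×-dec_; ¬?; dec-true; dec-false; decidable-stable)
import Relation.Unary as Unary

open Sum ℤ.+-0-commutativeMonoid using () renaming (sum to ∑)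
open Sum ℤ.*-1-commutativeMonoid using () renaming (sum to ∏)

private
  variable
    a k m n p q : ℕ

-- Divisibility by primes

[m*n]^k≡m^k*n^k : ∀ m n k → (m * n) ^ k ≡ m ^ k * n ^ k
[m*n]^k≡m^k*n^k m n zero    = refl
[m*n]^k≡m^k*n^k m n (suc k) = trans (cong ((m * n) *_) ([m*n]^k≡m^k*n^k m n k))
                                    ([m*n]*[o*p]≡[m*o]*[n*p] m n (m ^ k) (n ^ k))

prime∣prime⇒≡ : Prime p → Prime q → p ∣ q → p ≡ q
prime∣prime⇒≡ {p} pp pq p∣q with prime⇒irreducible pq p∣q
... | inj₁ refl = contradiction pp ¬prime[1]
... | inj₂ p≡q  = p≡q

prime∤1 : Prime p → ¬ p ∣ 1
prime∤1 pp p∣1 = ¬prime[1] (subst Prime (∣1⇒≡1 p∣1) pp)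

prime∣^⇒∣ : Prime p → ∀ k → p ∣ m ^ k → p ∣ m
prime∣^⇒∣ pp zero    p∣1 = contradiction p∣1 (prime∤1 pp)
prime∣^⇒∣ {m = m} pp (suc k) p∣mm^k with euclidsLemma m (m ^ k) pp p∣mm^k
... | inj₁ p∣m   = p∣m
... | inj₂ p∣m^k = prime∣^⇒∣ pp k p∣m^k

∤⇒coprime : Prime q → ¬ q ∣ a → Coprime a q
∤⇒coprime pq q∤a (d∣a , d∣q) with prime⇒irreducible pq d∣q
... | inj₁ d≡1 = d≡1
... | inj₂ d≡q = contradiction (subst (_∣ _) d≡q d∣a) q∤a

∣q^k*m⇒∣m : Prime q → ¬ q ∣ a → ∀ k → a ∣ q ^ k * m → a ∣ m
∣q^k*m⇒∣m {q} {a} {m} pq q∤a zero    a∣ = subst (a ∣_) (*-identityˡ m) a∣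
∣q^k*m⇒∣m {q} {a} {m} pq q∤a (suc k) a∣ = ∣q^k*m⇒∣m pq q∤a k
  (coprime-divisor (∤⇒coprime pq q∤a) (subst (a ∣_) (*-assoc q (q ^ k) m) a∣))

∣[p*q]^k∧q∤⇒∣p^k : Prime q → ¬ q ∣ a → ∀ k → a ∣ (p * q) ^ k → a ∣ p ^ k
∣[p*q]^k∧q∤⇒∣p^k {q} {a} {p} pq q∤a k a∣ = ∣q^k*m⇒∣m pq q∤a k
  (subst (a ∣_) (trans (cong (_^ k) (*-comm p q)) ([m*n]^k≡m^k*n^k q p k)) a∣)

∣p^k⇒≡p^x : Prime p → ∀ k → a ∣ p ^ k → ∃[ x ] a ≡ p ^ x
∣p^k⇒≡p^x pp zero a∣1 = 0 , ∣1⇒≡1 a∣1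
∣p^k⇒≡p^x {p} {a} pp (suc k) a∣ with p ∣? a
... | no p∤a = ∣p^k⇒≡p^x pp k (coprime-divisor (∤⇒coprime pp p∤a) a∣)
... | yes (divides b a≡b*p) with ∣p^k⇒≡p^x {a = b} pp k
    (*-cancelˡ-∣ p {{prime⇒nonZero pp}} (subst (_∣ p ^ suc k) (trans a≡b*p (*-comm b p)) a∣))
...   | x , b≡p^x = suc x , trans a≡b*p (trans (*-comm b p) (cong (p *_) b≡p^x))

-- By Euclid's lemma a new prime divides either the cofactor or the product of the earlier primes;
-- in the latter case unique factorisation would make it one of them.
product-distinct-primes-∣ : ∀ {ps} → All Prime ps → Unique ps → All (_∣ n) ps → product ps ∣ n
product-distinct-primes-∣ [] _ _ = 1∣ _
product-distinct-primes-∣ {ps = p ∷ ps} (pp ∷ pps) u@(_ ∷ us) (p∣n ∷ ps∣n)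
  with product-distinct-primes-∣ pps us ps∣n
... | divides c refl with euclidsLemma c (product ps) pp p∣n
...   | inj₁ p∣c  = *-monoˡ-∣ (product ps) p∣c
...   | inj₂ p∣ps = contradiction (factorisationHasAllPrimeFactors pp p∣ps pps)
                                  (Unique.Unique[x∷xs]⇒x∉xs u)

-- The radical is a product of distinct primes, each of which divides `m`. The resulting bound does
-- not involve `k`, and this is what lets the conjecture limit the exponents of the units.
rad-∣ : ∀ N m k → ∣ N ∣ ∣ m ^ k → rad N ∣ m
rad-∣ N m k N∣m^k = product-distinct-primes-∣
  (All.map proj₁ prime-divisors)
  (Unique.filter⁺ P? (Unique.upTo⁺ (suc ∣ N ∣)))
  (All.map (λ (pp , p∣N) → prime∣^⇒∣ pp k (∣-trans p∣N N∣m^k)) prime-divisors)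
  where
  P? = λ p → prime? p ×-dec (p ∣? ∣ N ∣)
  prime-divisors = All.all-filter P? (upTo (suc ∣ N ∣))

prime-divisor : ∀ n → 2 ≤ n → ∃[ p ] (Prime p × p ∣ n)
prime-divisor n@(suc _) 2≤n with factorise n
... | record { factors = [] ; isFactorisation = refl } = contradiction 2≤n λ { (s≤s ()) }
... | record { factors = p ∷ ps ; isFactorisation = eq ; factorsPrime = pp ∷ _ } =
  p , pp , subst (p ∣_) (sym eq) (m∣m*n (product ps))

-- A supply of primes

n!≤m^n : n ≤ m → n ! ≤ m ^ n
n!≤m^n {zero}  _   = ≤-refl
n!≤m^n {suc n} n<m = *-mono-≤ n<m (n!≤m^n (<⇒≤ n<m))

-- The shift by 4 is needed because the inequality fails at 3. The induction step uses that, for n =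
-- 4 + k, the difference 2n² - (n + 1)² equals 7 + 6k + k².
n*n≤2^n : ∀ k → (4 + k) * (4 + k) ≤ 2 ^ (4 + k)
n*n≤2^n zero    = ≤-refl
n*n≤2^n (suc k) = begin
  (5 + k) * (5 + k)                                ≤⟨ m≤m+n _ (7 + 6 * k + k * k) ⟩
  (5 + k) * (5 + k) + (7 + 6 * k + k * k)          ≡⟨ expand k ⟩
  2 * ((4 + k) * (4 + k))                          ≤⟨ *-monoʳ-≤ 2 (n*n≤2^n k) ⟩
  2 * 2 ^ (4 + k)                                  ∎
  where
  open ≤-Reasoning
  expand : ∀ k → (5 + k) * (5 + k) + (7 + 6 * k + k * k) ≡ 2 * ((4 + k) * (4 + k))
  expand = ℕ-Solver.solve-∀

m≤n⇒m∣n! : 1 ≤ m → m ≤ n → m ∣ n !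
m≤n⇒m∣n! {suc m} {n} _ m<n = ∣-trans (m∣m*n (m !)) (m≤n⇒m!∣n! m<n)

-- A common prime factor of 1 + i · B! and 1 + j · B! divides (j − i) · B!, hence
-- B!.  The index is shifted by one.
module Gödel (B : ℕ) where

  gödel : ℕ → ℕ
  gödel i = suc (suc i * B !)

  p∣gödel⇒p∤B! : ∀ i → Prime p → p ∣ gödel i → ¬ p ∣ B !
  p∣gödel⇒p∤B! {p} i pp p∣ p∣B! = prime∤1 pp
    (∣m+n∣m⇒∣n (subst (p ∣_) (+-comm 1 (suc i * B !)) p∣) (∣n⇒∣m*n (suc i) p∣B!))

  p∣gödel⇒B<p : ∀ i → Prime p → p ∣ gödel i → B < p
  p∣gödel⇒B<p i pp p∣ = ≰⇒> λ p≤B →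
    p∣gödel⇒p∤B! i pp p∣ (m≤n⇒m∣n! (ℕ.>-nonZero⁻¹ _ {{prime⇒nonZero pp}}) p≤B)

  gödel-coprime : ∀ i d → suc i + d < B → Prime p → p ∣ gödel i → ¬ p ∣ gödel (suc i + d)
  gödel-coprime {p} i d j<B pp p∣gᵢ p∣gⱼ
    with euclidsLemma (suc d) (B !) pp (∣m+n∣m⇒∣n (subst (p ∣_) (difference i d (B !)) p∣gⱼ) p∣gᵢ)
    where
    difference : ∀ i d f → suc (suc (suc i + d) * f) ≡ suc (suc i * f) + suc d * f
    difference = ℕ-Solver.solve-∀
  -- Here `suc d` ≤ B < p, so `p` is too large to divide it.
  ... | inj₁ p∣d  = <⇒≱ (p∣gödel⇒B<p i pp p∣gᵢ)
          (≤-trans (∣⇒≤ p∣d) (≤-trans (s≤s (m≤n+m d i)) (<⇒≤ j<B)))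
  ... | inj₂ p∣B! = p∣gödel⇒p∤B! i pp p∣gᵢ p∣B!

  gödel-prime : ∀ i → ∃[ p ] (Prime p × p ∣ gödel i)
  gödel-prime i = prime-divisor (gödel i) (s≤s (≤-trans (1≤n! B) (m≤m+n (B !) (i * B !))))

  primeAt : Fin B → ℕ
  primeAt i = proj₁ (gödel-prime (toℕ i))

  isPrime : ∀ i → Prime (primeAt i)
  isPrime i = proj₁ (proj₂ (gödel-prime (toℕ i)))

  prime∣gödel : ∀ i → primeAt i ∣ gödel (toℕ i)
  prime∣gödel i = proj₂ (proj₂ (gödel-prime (toℕ i)))

  <⇒prime-≢ : ∀ i j → toℕ i < toℕ j → primeAt i ≢ primeAt j
  <⇒prime-≢ i j i<j eq with m≤n⇒∃[o]m+o≡n i<j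
  ... | d , si+d≡j = gödel-coprime (toℕ i) d (subst (_< B) (sym si+d≡j) (Fin.toℕ<n j))
    (isPrime i) (prime∣gödel i)
    (subst₂ _∣_ (sym eq) (cong gödel (sym si+d≡j)) (prime∣gödel j))

  prime-injective : ∀ {i j} → primeAt i ≡ primeAt j → i ≡ j
  prime-injective {i} {j} eq with <-cmp (toℕ i) (toℕ j)
  ... | tri< i<j _ _ = contradiction eq (<⇒prime-≢ i j i<j)
  ... | tri≈ _ i≡j _ = Fin.toℕ-injective i≡j
  ... | tri> _ _ i>j = contradiction (sym eq) (<⇒prime-≢ j i i>j)

  B<primeAt : ∀ i → B < primeAt i
  B<primeAt i = p∣gödel⇒B<p (toℕ i) (isPrime i) (prime∣gödel i)

  prime≤ : ∀ i → primeAt i ≤ suc (B * B !)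
  prime≤ i = ≤-trans (∣⇒≤ (prime∣gödel i)) (s≤s (*-monoˡ-≤ (B !) (Fin.toℕ<n i)))

  primes : List ℕ
  primes = List.tabulate primeAt

  primes-unique : Unique primes
  primes-unique = Unique.tabulate⁺ prime-injective

-- Intervals containing many primes

length-filter-∁ : ∀ {A : Set} {P : A → Set} (P? : Unary.Decidable P) xs →
  length (filter P? xs) + length (filter (¬? ∘ P?) xs) ≡ length xs
length-filter-∁ P? []       = refl
length-filter-∁ P? (x ∷ xs) with P? x
... | yes _ = cong suc (length-filter-∁ P? xs)
... | no  _ = trans (+-suc _ _) (cong suc (length-filter-∁ P? xs))

record PrimeBlock (N L : ℕ) : Set where
  constructor primeBlock
  field
    primes   : List ℕ
    isPrime  : All Prime primes
    isUnique : Unique primes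
    lower    : All (L <_) primes
    upper    : All (_≤ L ^ 2) primes
    many     : N < length primes

-- The intervals (L ^ 2 ^ j , L ^ 2 ^ (j + 1)], j < J, cover (L , L ^ 2 ^ J].
pigeonhole-blocks : ∀ N J L .{{_ : NonZero L}} ps → All Prime ps → Unique ps →
  All (L <_) ps → All (_≤ L ^ 2 ^ J) ps → J * N < length ps →
  ∃[ L′ ] (L ≤ L′ × PrimeBlock N L′)
-- With no interval left, a listed prime would satisfy L < p ≤ L.
pigeonhole-blocks N zero L (p ∷ _) _ _ (L<p ∷ _) (p≤L ∷ _) _ =
  contradiction (≤-trans L<p (subst (p ≤_) (^-identityʳ L) p≤L)) (<-irrefl refl)
pigeonhole-blocks N (suc J) L ps pps ups L<ps ps≤ many with N <? length (filter (_≤? L ^ 2) ps)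
... | yes N<low = L , ≤-refl , primeBlock (filter (_≤? L ^ 2) ps)
  (All.filter⁺ _ pps) (Unique.filter⁺ _ ups) (All.filter⁺ _ L<ps) (All.all-filter _ ps) N<low
-- The lowest interval holds at most `N` of the primes, so more than J · N of them exceed L², and
-- the search continues from L², where (L²) ^ 2ᴶ = L ^ 2ᴶ⁺¹.
... | no N≮low
  with pigeonhole-blocks N J (L ^ 2) {{m^n≢0 L 2}} high (All.filter⁺ _ pps) (Unique.filter⁺ _ ups)
         (All.map ≰⇒> (All.all-filter _ ps))
         (All.map (subst (_ ≤_) (sym (^-*-assoc L 2 (2 ^ J)))) (All.filter⁺ _ ps≤))
         (+-cancelˡ-< N _ _ (<-≤-trans many (≤-trans
           (≤-reflexive (sym (length-filter-∁ (_≤? L ^ 2) ps)))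
           (+-monoˡ-≤ (length high) (≮⇒≥ N≮low)))))
    where high = filter (¬? ∘ (_≤? L ^ 2)) ps
...   | L′ , L²≤L′ , block = L′ , ≤-trans (m≤m*n L (L ^ 1) {{m^n≢0 L 1}}) L²≤L′ , block

-- The `B` primes taken from Gödel's numbers exceed B and are at most 1 + B · B! ≤ B ^ (2 + B), so
-- `J` intervals starting at `B` capture all of them.
primeBlock-above : ∀ N J B → 2 ≤ B → J * N < B → 2 + B ≤ 2 ^ J →
  ∃[ L ] (B ≤ L × PrimeBlock N L)
primeBlock-above N J B 2≤B J*N<B 2+B≤2^J =
  pigeonhole-blocks N J B primes (All.tabulate⁺ isPrime) primes-unique
    (All.tabulate⁺ B<primeAt)
    (All.tabulate⁺ λ i → ≤-trans (prime≤ i) bound)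
    (<-≤-trans J*N<B (≤-reflexive (sym (List.length-tabulate primeAt))))
  where
  open Gödel B
  open ≤-Reasoning
  instance
    B-nonZero : NonZero B
    B-nonZero = ℕ.>-nonZero (<⇒≤ 2≤B)
  bound : suc (B * B !) ≤ B ^ 2 ^ J
  bound = begin
    suc (B * B !)      ≤⟨ +-monoˡ-≤ (B * B !) (*-mono-≤ (<⇒≤ 2≤B) (1≤n! B)) ⟩
    B * B ! + B * B !  ≡⟨ cong (λ b → B * B ! + b) (+-identityʳ (B * B !)) ⟨
    2 * (B * B !)      ≤⟨ *-mono-≤ 2≤B (*-monoʳ-≤ B (n!≤m^n {B} {B} ≤-refl)) ⟩
    B ^ (2 + B)        ≤⟨ ^-monoʳ-≤ B 2+B≤2^J ⟩
    B ^ 2 ^ J          ∎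

primeBlock-exists : ∀ N L₀ → ∃[ L ] (L₀ ≤ L × PrimeBlock (suc N) L)
primeBlock-exists N L₀ =
  let L , B≤L , block = primeBlock-above (suc N) J (suc (J * suc N)) (s≤s (s≤s z≤n)) ≤-refl exponent
  in L , ≤-trans L₀≤B B≤L , block
  where
  open ≤-Reasoning
  -- The number `B` of primes is linear in `J`, while the covered range needs only 2 + B ≤ 2ᴶ. The
  -- summand 4 makes J² ≤ 2ᴶ available, 4 + N ≤ J bounds 3 + J (N + 1) by J², and `L₀` forces B ≥
  -- L₀.
  J = 4 + (N + L₀)
  exponent : 3 + J * suc N ≤ 2 ^ J
  exponent = begin
    3 + J * suc N      ≤⟨ +-monoˡ-≤ (J * suc N) (m≤n*m 3 J) ⟩
    J * 3 + J * suc N  ≡⟨ *-distribˡ-+ J 3 (suc N) ⟨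
    J * (4 + N)        ≤⟨ *-monoʳ-≤ J (+-monoʳ-≤ 4 (m≤m+n N L₀)) ⟩
    J * J              ≤⟨ n*n≤2^n (N + L₀) ⟩
    2 ^ J              ∎
  L₀≤B : L₀ ≤ suc (J * suc N)
  L₀≤B = ≤-trans (m≤n+m L₀ (4 + N)) (≤-trans (m≤m*n J (suc N)) (n≤1+n _))

-- Sums of signed powers of p

pos-^ neg-^ : ℕ → ℕ → ℤ
pos-^ p x = + (p ^ x)
neg-^ p x = ℤ.- + (p ^ x)

-- The entry `0ℤ` stands for the terms masked out in `sumOver`, so that every subsum of an n-vector
-- is again a sum of exactly n elements of the list.
signedPowers : ℕ → ℕ → List ℤ
signedPowers p D = 0ℤ ∷ List.map (pos-^ p) (upTo D) ++ List.map (neg-^ p) (upTo D)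

sums : ℕ → List ℤ → List ℤ
sums zero    U = 0ℤ ∷ []
sums (suc n) U = cartesianProductWith ℤ._+_ U (sums n U)

length-signedPowers : ∀ p D → length (signedPowers p D) ≡ suc (2 * D)
length-signedPowers p D = cong suc (begin
  length (xs ++ ys)        ≡⟨ List.length-++ xs ⟩
  length xs + length ys    ≡⟨ cong₂ _+_ (List.length-map _ (upTo D)) (List.length-map _ (upTo D)) ⟩
  length (upTo D) + length (upTo D)  ≡⟨ cong (λ l → l + l) (List.length-upTo D) ⟩
  D + D                    ≡⟨ cong (λ d → D + d) (+-identityʳ D) ⟨
  2 * D                    ∎)
  where
  open ≡-Reasoning
  xs = List.map (pos-^ p) (upTo D)
  ys = List.map (neg-^ p) (upTo D)

length-cartesianProductWith : ∀ {A B C : Set} (f : A → B → C) xs ys →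
  length (cartesianProductWith f xs ys) ≡ length xs * length ys
length-cartesianProductWith f []       ys = refl
length-cartesianProductWith f (x ∷ xs) ys = trans (List.length-++ (List.map (f x) ys))
  (cong₂ _+_ (List.length-map (f x) ys) (length-cartesianProductWith f xs ys))

length-sums : ∀ n U → length (sums n U) ≡ length U ^ n
length-sums zero    U = refl
length-sums (suc n) U = trans (length-cartesianProductWith ℤ._+_ U (sums n U))
                              (cong (length U *_) (length-sums n U))

∣w∣≡p^x⇒w∈signedPowers : ∀ p D x w → x < D → ∣ w ∣ ≡ p ^ x → w ∈ signedPowers p D
∣w∣≡p^x⇒w∈signedPowers p D x (+ m) x<D refl = there (∈.∈-++⁺ˡ
  (∈.∈-map⁺ (pos-^ p) (∈.∈-upTo⁺ x<D)))
∣w∣≡p^x⇒w∈signedPowers p D x -[1+ m ] x<D eq = there (∈.∈-++⁺ʳ (List.map (pos-^ p) (upTo D))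
  (subst (λ m → ℤ.- + m ∈ List.map (neg-^ p) (upTo D)) (sym eq) (∈.∈-map⁺ (neg-^ p) (∈.∈-upTo⁺ x<D))))

signedPowers-bound : ∀ p .{{_ : NonZero p}} D → All (λ w → ∣ w ∣ ≤ p ^ D) (signedPowers p D)
signedPowers-bound p D = z≤n ∷ All.++⁺
  (All.map⁺ {f = pos-^ p} (All.tabulate p^x≤p^D))
  (All.map⁺ {f = neg-^ p} (All.tabulate λ {x} x∈ →
    subst (_≤ p ^ D) (sym (ℤ.∣-i∣≡∣i∣ (+ (p ^ x)))) (p^x≤p^D x∈)))
  where
  p^x≤p^D : ∀ {x} → x ∈ upTo D → p ^ x ≤ p ^ D
  p^x≤p^D x∈ = ^-monoʳ-≤ p (<⇒≤ (∈.∈-upTo⁻ x∈))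

sums-bound : ∀ {M U} n → All (λ w → ∣ w ∣ ≤ M) U → All (λ w → ∣ w ∣ ≤ n * M) (sums n U)
sums-bound zero    _  = z≤n ∷ []
sums-bound {U = U} (suc n) U≤ = All.cartesianProductWith⁺ (setoid ℤ) (setoid ℤ) ℤ._+_ U (sums n U)
  λ {u} {w} u∈ w∈ → ≤-trans (ℤ.∣i+j∣≤∣i∣+∣j∣ u w)
                            (+-mono-≤ (All.lookup U≤ u∈) (All.lookup (sums-bound n U≤) w∈))

∑-∈-sums : ∀ {n U} (v : Vector ℤ n) → (∀ i → v i ∈ U) → ∑ v ∈ sums n U
∑-∈-sums {zero}  v v∈ = here refl
∑-∈-sums {suc n} v v∈ = ∈.∈-cartesianProductWith⁺ ℤ._+_ (v∈ 0F) (∑-∈-sums (v ∘ Fin.suc) (v∈ ∘ Fin.suc))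

product-map-≤ : ∀ {A : Set} (f : A → ℕ) {M xs} → All (λ x → f x ≤ M) xs →
  product (List.map f xs) ≤ M ^ length xs
product-map-≤ f []         = ≤-refl
product-map-≤ f (x≤ ∷ xs≤) = *-mono-≤ x≤ (product-map-≤ f xs≤)

^-length≤product : ∀ {L ps} → All (L <_) ps → L ^ length ps ≤ product ps
^-length≤product []         = ≤-refl
^-length≤product (L<p ∷ L<) = *-mono-≤ (<⇒≤ L<p) (^-length≤product L<)

-- A choice of primes

Avoids : (q n : ℕ) → List ℤ → Set
Avoids q n U = ∀ w → w ∈ sums n U → w ≢ 0ℤ → ¬ q ∣ ∣ w ∣

-- The avoidance condition is one-sided: it concerns powers of `p₁` modulo `p₂`. Modulo `p₁` only
-- signs will be left to add, and there the size of `p₁` suffices.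
record PrimePair (n D L : ℕ) : Set where
  field
    p₁ p₂    : ℕ
    p₁-prime : Prime p₁
    p₂-prime : Prime p₂
    p₁≢p₂    : p₁ ≢ p₂
    L<p₁     : L < p₁
    L<p₂     : L < p₂
    p₁≤L²    : p₁ ≤ L ^ 2
    p₂≤L²    : p₂ ≤ L ^ 2
    avoids   : Avoids p₂ n (signedPowers p₁ D)

-- All nonzero sums divide Q ≤ L ^ N, so Q cannot be divisible by more than N
-- primes exceeding L.
primePair : ∀ n D L → 1 ≤ n → n ≤ L → 2 ≤ L →
  PrimeBlock (suc (suc (2 * D) ^ suc n)) L → PrimePair n D L
-- The first prime of the block becomes `p₁`; more than `N` candidates for `p₂` remain.
primePair n D L 1≤n n≤L 2≤L
  (primeBlock (p ∷ qs) (p-prime ∷ qs-prime) (p≢qs ∷ qs-unique) (L<p ∷ L<qs) (p≤L² ∷ qs≤L²) (s≤s many))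
  = record
  { p₁-prime = p-prime
  ; p₂-prime = All.lookup qs-prime q∈
  ; p₁≢p₂    = All.lookup p≢qs q∈
  ; L<p₁     = L<p
  ; L<p₂     = All.lookup L<qs q∈
  ; p₁≤L²    = p≤L²
  ; p₂≤L²    = All.lookup qs≤L² q∈
  ; avoids   = avoids
  }
  where
  open ≤-Reasoning
  instance
    p-nonZero : NonZero p
    p-nonZero = prime⇒nonZero p-prime
    L-nonZero : NonZero L
    L-nonZero = ℕ.>-nonZero (<⇒≤ 2≤L)
  -- There are (2D + 1)ⁿ sums, each of absolute value at most n pᴰ ≤ L ^ (2D + 1); the exponent `N`
  -- is the product of 2D + 1 and their number.
  N = suc (2 * D) ^ suc n
  W = sums n (signedPowers p D)
  -- The vanishing sums must not make Q zero.
  positive : ℤ → ℕ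
  positive w = ∣ w ∣ ⊔ 1
  Q = product (List.map positive W)

  n*p^D≤ : n * p ^ D ≤ L ^ suc (2 * D)
  n*p^D≤ = begin
    n * p ^ D          ≤⟨ *-mono-≤ n≤L (^-monoˡ-≤ D p≤L²) ⟩
    L * (L ^ 2) ^ D    ≡⟨ cong (L *_) (^-*-assoc L 2 D) ⟩
    L ^ suc (2 * D)    ∎

  Q≤L^N : Q ≤ L ^ N
  Q≤L^N = begin
    Q                            ≤⟨ product-map-≤ positive (All.map (λ {w} → positive≤ {w}) (sums-bound n (signedPowers-bound p D))) ⟩
    (n * p ^ D) ^ length W       ≤⟨ ^-monoˡ-≤ (length W) n*p^D≤ ⟩
    (L ^ suc (2 * D)) ^ length W ≡⟨ ^-*-assoc L (suc (2 * D)) (length W) ⟩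
    L ^ (suc (2 * D) * length W) ≡⟨ cong (λ l → L ^ (suc (2 * D) * l)) (trans (length-sums n (signedPowers p D)) (cong (_^ n) (length-signedPowers p D))) ⟩
    L ^ N                        ∎
    where
    positive≤ : ∀ {w} → ∣ w ∣ ≤ n * p ^ D → positive w ≤ n * p ^ D
    positive≤ w≤ = ⊔-lub w≤ (*-mono-≤ 1≤n (m^n>0 p D))

  Q-nonZero : NonZero Q
  Q-nonZero = product≢0 (All.map⁺ (All.universal (λ w → ℕ.>-nonZero (m≤n⊔m ∣ w ∣ 1)) W))

  ¬qs∣Q : ¬ All (_∣ Q) qs
  ¬qs∣Q qs∣Q = <-irrefl refl (begin-strict
    L ^ N          <⟨ ^-monoʳ-< L 2≤L many ⟩
    L ^ length qs  ≤⟨ ^-length≤product L<qs ⟩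
    product qs     ≤⟨ ∣⇒≤ {{Q-nonZero}} (product-distinct-primes-∣ qs-prime qs-unique qs∣Q) ⟩
    Q              ≤⟨ Q≤L^N ⟩
    L ^ N          ∎)

  witness : Any.Any (λ q → ¬ q ∣ Q) qs
  witness = All.¬All⇒Any¬ (_∣? Q) qs ¬qs∣Q

  q∈ : Any.lookup witness ∈ qs
  q∈ = ∈.∈-lookup {xs = qs} (Any.index witness)

  avoids : Avoids (Any.lookup witness) n (signedPowers p D)
  avoids w w∈ w≢0 q∣w = Any.lookup-result witness (∣-trans q∣w (subst (_∣ Q) positive-w
    (∈⇒∣product (∈.∈-map⁺ positive w∈))))
    where
    positive-w : positive w ≡ ∣ w ∣
    positive-w = m≥n⇒m⊔n≡m (n≢0⇒n>0 (w≢0 ∘ ℤ.∣i∣≡0⇒i≡0))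

-- Integer vectors without vanishing subsums

private
  variable
    d : ℕ

∣gcd∣ : ∀ (v : Vector ℤ n) i → ∣ gcd v ∣ ∣ ∣ v i ∣
∣gcd∣ v 0F          = ℤ.gcd[i,j]∣i (v 0F) (gcd (v ∘ Fin.suc))
∣gcd∣ v (Fin.suc i) = ∣-trans (ℤ.gcd[i,j]∣j (v 0F) (gcd (v ∘ Fin.suc))) (∣gcd∣ (v ∘ Fin.suc) i)

gcd-greatest : (v : Vector ℤ n) → (∀ i → d ∣ ∣ v i ∣) → d ∣ ∣ gcd v ∣
gcd-greatest {zero}      v d∣v = _ ∣0
gcd-greatest {suc n} {d} v d∣v = ℤ.gcd-greatest {v 0F} {gcd (v ∘ Fin.suc)} {+ d}
  (d∣v 0F) (gcd-greatest (v ∘ Fin.suc) (d∣v ∘ Fin.suc))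

∣v∣≤max : ∀ (v : Vector ℤ n) i → ∣ v i ∣ ≤ max∣ v ∣
∣v∣≤max v 0F          = m≤m⊔n _ _
∣v∣≤max v (Fin.suc i) = ≤-trans (∣v∣≤max (v ∘ Fin.suc) i) (m≤n⊔m ∣ v 0F ∣ _)

∏-∣ : (v : Vector ℤ n) → (∀ i → ∣ v i ∣ ∣ m ^ k) → ∃[ l ] ∣ ∏ v ∣ ∣ m ^ l
∏-∣ {zero}          v v∣ = 0 , ∣-refl
∏-∣ {suc n} {m} {k} v v∣ with ∏-∣ {k = k} (v ∘ Fin.suc) (v∣ ∘ Fin.suc)
... | l , ∏∣ = k + l , subst₂ _∣_ (sym (ℤ.abs-* (v 0F) (∏ (v ∘ Fin.suc)))) (sym (^-distribˡ-+-* m k l))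
                         (*-pres-∣ (v∣ 0F) ∏∣)

∣∑∣≤ : ∀ {M} (v : Vector ℤ n) → (∀ i → ∣ v i ∣ ≤ M) → ∣ ∑ v ∣ ≤ n * M
∣∑∣≤ {zero}  v v≤ = z≤n
∣∑∣≤ {suc n} v v≤ = ≤-trans (ℤ.∣i+j∣≤∣i∣+∣j∣ (v 0F) (∑ (v ∘ Fin.suc)))
                            (+-mono-≤ (v≤ 0F) (∣∑∣≤ (v ∘ Fin.suc) (v≤ ∘ Fin.suc)))

∣∑-sumOver : ∀ {d} (S : Subset n) (v : Vector ℤ n) →
  (∀ i → lookup S i ≡ outside → d ℤ.∣ v i) → d ℤ.∣ ∑ v ℤ.- sumOver S v
∣∑-sumOver []      v d∣v = ℤ.divides 0ℤ refl
∣∑-sumOver {d = d} (s ∷ S) v d∣v = subst (d ℤ.∣_) (rearrange (v 0F) (if s then v 0F else 0ℤ) (∑ (v ∘ Fin.suc)) (sumOver S (v ∘ Fin.suc)))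
  (ℤ.∣m∣n⇒∣m+n (head s (d∣v 0F)) (∣∑-sumOver S (v ∘ Fin.suc) (d∣v ∘ Fin.suc)))
  where
  rearrange : ∀ a b c e → (a ℤ.- b) ℤ.+ (c ℤ.- e) ≡ (a ℤ.+ c) ℤ.- (b ℤ.+ e)
  rearrange = ℤ-Solver.solve-∀
  head : ∀ s → (s ≡ outside → d ℤ.∣ v 0F) → d ℤ.∣ v 0F ℤ.- (if s then v 0F else 0ℤ)
  head true  _  = ℤ.divides 0ℤ (ℤ.+-inverseʳ (v 0F))
  head false d∣ = subst (d ℤ.∣_) (sym (ℤ.+-identityʳ (v 0F))) (d∣ refl)

-- Subsums of the terms prime to a given prime

NoVanishingSubsum : Vector ℤ n → Set
NoVanishingSubsum v = ∀ S → Nonempty S → S ⊂ ⊤ → sumOver S v ≢ 0ℤ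

nonmultiples : ℕ → Vector ℤ n → Subset n
nonmultiples ℓ v = tabulate (λ i → does (¬? (ℓ ∣? ∣ v i ∣)))

∈nonmultiples : ∀ ℓ (v : Vector ℤ n) i → ¬ ℓ ∣ ∣ v i ∣ → lookup (nonmultiples ℓ v) i ≡ inside
∈nonmultiples ℓ v i ℓ∤ = trans (lookup∘tabulate _ i) (dec-true (¬? (ℓ ∣? ∣ v i ∣)) ℓ∤)

∉nonmultiples : ∀ ℓ (v : Vector ℤ n) i → ℓ ∣ ∣ v i ∣ → lookup (nonmultiples ℓ v) i ≡ outside
∉nonmultiples ℓ v i ℓ∣ = trans (lookup∘tabulate _ i) (dec-false (¬? (ℓ ∣? ∣ v i ∣)) (λ ℓ∤ → ℓ∤ ℓ∣))

outside⇒∣ : ∀ ℓ (v : Vector ℤ n) i → lookup (nonmultiples ℓ v) i ≡ outside → ℓ ∣ ∣ v i ∣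
outside⇒∣ ℓ v i eq with ℓ ∣? ∣ v i ∣
... | yes ℓ∣ = ℓ∣
... | no  ℓ∤ = contradiction (trans (sym (∈nonmultiples ℓ v i ℓ∤)) eq) λ ()

∣sumOver-nonmultiples : ∀ ℓ (v : Vector ℤ n) → ∑ v ≡ 0ℤ → ℓ ∣ ∣ sumOver (nonmultiples ℓ v) v ∣
∣sumOver-nonmultiples ℓ v ∑v≡0 = subst (ℓ ∣_) (trans (cong (λ s → ∣ s ℤ.- s′ ∣) ∑v≡0) (trans (cong ∣_∣ (ℤ.+-identityˡ (ℤ.- s′))) (ℤ.∣-i∣≡∣i∣ s′)))
  (ℤ.∣⇒∣ᵤ {+ ℓ} (∣∑-sumOver (nonmultiples ℓ v) v λ i out → ℤ.∣ᵤ⇒∣ (outside⇒∣ ℓ v i out)))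
  where s′ = sumOver (nonmultiples ℓ v) v

-- Since the gcd is 1, some entry is prime to ℓ, so the set of such entries is nonempty. A multiple
-- of ℓ among the entries would make it a proper subset with zero sum.
vanishing-nonmultiples : ∀ ℓ (v : Vector ℤ n) → Prime ℓ → NoVanishingSubsum v → gcd v ≡ 1ℤ →
  sumOver (nonmultiples ℓ v) v ≡ 0ℤ → ∀ i → ¬ ℓ ∣ ∣ v i ∣
vanishing-nonmultiples ℓ v pℓ noSub gcd≡1 sum≡0 i ℓ∣vᵢ =
  noSub S nonempty proper sum≡0
  where
  S = nonmultiples ℓ v
  ¬ℓ∣v : ¬ (∀ j → ℓ ∣ ∣ v j ∣)
  ¬ℓ∣v ℓ∣v = prime∤1 pℓ (subst (λ g → ℓ ∣ ∣ g ∣) gcd≡1 (gcd-greatest v ℓ∣v))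
  nonempty : Nonempty S
  nonempty with Fin.¬∀⟶∃¬ _ _ (λ j → ℓ ∣? ∣ v j ∣) ¬ℓ∣v
  ... | j , ℓ∤vⱼ = j , Vec.lookup⇒[]= j S (∈nonmultiples ℓ v j ℓ∤vⱼ)
  proper : S ⊂ ⊤
  proper = (λ _ → Subset.∈⊤) , i , Subset.∈⊤ ,
    λ i∈S → contradiction (trans (sym (Vec.[]=⇒lookup i∈S)) (∉nonmultiples ℓ v i ℓ∣vᵢ)) λ ()

^-cancelˡ-< : ∀ p .{{_ : NonZero p}} {x D} → p ^ x < p ^ D → x < D
^-cancelˡ-< p p^x<p^D = ≰⇒> λ D≤x → <⇒≱ p^x<p^D (^-monoʳ-≤ p D≤x)

units-of-absolute-value-1 : ∀ {D} (v : Vector ℤ n) → Prime p → Prime q → n < p →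
  Avoids q n (signedPowers p D) →
  NoVanishingSubsum v → gcd v ≡ 1ℤ → ∑ v ≡ 0ℤ →
  (∀ i → ∣ v i ∣ < p ^ D) → (∀ i → ∣ v i ∣ ∣ (p * q) ^ k) →
  ∀ i → ∣ v i ∣ ≡ 1
units-of-absolute-value-1 {n} {p} {q} {k} {D} v p-prime q-prime n<p avoids noSub gcd≡1 ∑v≡0 v< v∣ =
  λ i → q∤⇒p∤⇒≡1 i (q∤v i) (p∤v i)
  where
  instance
    p-nonZero : NonZero p
    p-nonZero = prime⇒nonZero p-prime

  q∤⇒∣p^k : ∀ i → ¬ q ∣ ∣ v i ∣ → ∣ v i ∣ ∣ p ^ k
  q∤⇒∣p^k i q∤ = ∣[p*q]^k∧q∤⇒∣p^k q-prime q∤ k (v∣ i)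

  q∤⇒p∤⇒≡1 : ∀ i → ¬ q ∣ ∣ v i ∣ → ¬ p ∣ ∣ v i ∣ → ∣ v i ∣ ≡ 1
  q∤⇒p∤⇒≡1 i q∤ p∤ = ∣1⇒≡1 (∣q^k*m⇒∣m p-prime p∤ k (subst (∣ v i ∣ ∣_) (sym (*-identityʳ (p ^ k))) (q∤⇒∣p^k i q∤)))

  -- An entry prime to `q` divides a power of `p`, and its size keeps the exponent below `D`; the
  -- masked entries contribute zero.
  q-sum∈ : sumOver (nonmultiples q v) v ∈ sums n (signedPowers p D)
  q-sum∈ = ∑-∈-sums _ entry
    where
    entry : ∀ i → (if lookup (nonmultiples q v) i then v i else 0ℤ) ∈ signedPowers p D
    entry i with q ∣? ∣ v i ∣
    ... | yes q∣ rewrite ∉nonmultiples q v i q∣ = here refl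
    ... | no q∤ rewrite ∈nonmultiples q v i q∤ with ∣p^k⇒≡p^x p-prime k (q∤⇒∣p^k i q∤)
    ...   | x , eq = ∣w∣≡p^x⇒w∈signedPowers p D x (v i)
                       (^-cancelˡ-< p (subst (_< p ^ D) eq (v< i))) eq

  q∤v : ∀ i → ¬ q ∣ ∣ v i ∣
  q∤v = vanishing-nonmultiples q v q-prime noSub gcd≡1
    (decidable-stable (_ ℤ.≟ 0ℤ) λ s≢0 → avoids _ q-sum∈ s≢0 (∣sumOver-nonmultiples q v ∑v≡0))

  -- As `q` divides no entry by `q∤v`, the entries prime to `p` are ±1. Their sum is a multiple of
  -- `p` of size at most n < p, hence zero.
  p-sum≤ : ∣ sumOver (nonmultiples p v) v ∣ ≤ n * 1
  p-sum≤ = ∣∑∣≤ _ entry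
    where
    entry : ∀ i → ∣ (if lookup (nonmultiples p v) i then v i else 0ℤ) ∣ ≤ 1
    entry i with p ∣? ∣ v i ∣
    ... | yes p∣ rewrite ∉nonmultiples p v i p∣ = z≤n
    ... | no p∤ rewrite ∈nonmultiples p v i p∤ = ≤-reflexive (q∤⇒p∤⇒≡1 i (q∤v i) p∤)

  p∤v : ∀ i → ¬ p ∣ ∣ v i ∣
  p∤v = vanishing-nonmultiples p v p-prime noSub gcd≡1 (ℤ.∣i∣≡0⇒i≡0 (decidable-stable (_ ≟ 0) λ s≢0 →
    <⇒≱ n<p (≤-trans (∣⇒≤ {{ℕ.≢-nonZero s≢0}} (∣sumOver-nonmultiples p v ∑v≡0))
                     (≤-trans p-sum≤ (≤-reflexive (*-identityʳ n))))))

-- Rational numbers with denominator dividing a power of P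

module _ (G : Unary.Pred ℚ 0ℓ) where
  private
    R = adjoin G
    module R = CommutativeRing R

  -- Induction along Horner's scheme: if h is the quotient for f, then f(x) + y h is the quotient
  -- for a + x f. The quotient is kept as a ring element because its denominator matters later.
  x-y∣f[x]-f[y] : ∀ (f : Polynomial R) (x y : R.Carrier) → ∃[ g ]
    proj₁ (eval R f x) ℚ.- proj₁ (eval R f y) ≡ (proj₁ x ℚ.- proj₁ y) ℚ.* proj₁ {B = ℤ[ G ]} g
  x-y∣f[x]-f[y] []      x y = (ℚ.0ℚ , zero) , sym (ℚ.*-zeroʳ (proj₁ x ℚ.- proj₁ y))
  x-y∣f[x]-f[y] (a ∷ f) x y with x-y∣f[x]-f[y] f x y
  ... | h , eq = eval R f x R.+ y R.* h , (begin
    (a₀ ℚ.+ x₀ ℚ.* F) ℚ.- (a₀ ℚ.+ y₀ ℚ.* H)                ≡⟨ expand a₀ x₀ y₀ F H ⟩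
    (x₀ ℚ.- y₀) ℚ.* F ℚ.+ y₀ ℚ.* (F ℚ.- H)                 ≡⟨ cong (λ z → (x₀ ℚ.- y₀) ℚ.* F ℚ.+ y₀ ℚ.* z) eq ⟩
    (x₀ ℚ.- y₀) ℚ.* F ℚ.+ y₀ ℚ.* ((x₀ ℚ.- y₀) ℚ.* proj₁ h) ≡⟨ factor (x₀ ℚ.- y₀) y₀ F (proj₁ h) ⟩
    (x₀ ℚ.- y₀) ℚ.* (F ℚ.+ y₀ ℚ.* proj₁ h)                 ∎)
    where
    open ≡-Reasoning
    open +-*-Solver
    a₀ = proj₁ a
    x₀ = proj₁ x
    y₀ = proj₁ y
    F  = proj₁ (eval R f x)
    H  = proj₁ (eval R f y)
    expand : ∀ a x y F H →
      (a ℚ.+ x ℚ.* F) ℚ.- (a ℚ.+ y ℚ.* H) ≡ (x ℚ.- y) ℚ.* F ℚ.+ y ℚ.* (F ℚ.- H)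
    expand = solve 5 (λ a x y F H →
      (a :+ x :* F) :- (a :+ y :* H) := (x :- y) :* F :+ y :* (F :- H)) refl
    factor : ∀ d y F h → d ℚ.* F ℚ.+ y ℚ.* (d ℚ.* h) ≡ d ℚ.* (F ℚ.+ y ℚ.* h)
    factor = solve 4 (λ d y F h → d :* F :+ y :* (d :* h) := d :* (F :+ y :* h)) refl

-- The integers inside the rationals

ι : ℤ → ℚ
ι z = z ℚ./ 1

-- The operations are compared on unnormalised fractions, where no common factors are cancelled;
-- this gives the homomorphism laws of `ι`.
fromℚᵘ-homo-* : ∀ x y → ℚ.fromℚᵘ (x ℚᵘ.* y) ≡ ℚ.fromℚᵘ x ℚ.* ℚ.fromℚᵘ y
fromℚᵘ-homo-* x y = trans (ℚ.fromℚᵘ-cong (ℚᵘ.≃-sym (ℚᵘ.≃-trans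
  (ℚ.toℚᵘ-homo-* (ℚ.fromℚᵘ x) (ℚ.fromℚᵘ y)) (ℚᵘ.*-cong (ℚ.toℚᵘ-fromℚᵘ x) (ℚ.toℚᵘ-fromℚᵘ y)))))
  (ℚ.fromℚᵘ-toℚᵘ (ℚ.fromℚᵘ x ℚ.* ℚ.fromℚᵘ y))

fromℚᵘ-homo-+ : ∀ x y → ℚ.fromℚᵘ (x ℚᵘ.+ y) ≡ ℚ.fromℚᵘ x ℚ.+ ℚ.fromℚᵘ y
fromℚᵘ-homo-+ x y = trans (ℚ.fromℚᵘ-cong (ℚᵘ.≃-sym (ℚᵘ.≃-trans
  (ℚ.toℚᵘ-homo-+ (ℚ.fromℚᵘ x) (ℚ.fromℚᵘ y)) (ℚᵘ.+-cong (ℚ.toℚᵘ-fromℚᵘ x) (ℚ.toℚᵘ-fromℚᵘ y)))))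
  (ℚ.fromℚᵘ-toℚᵘ (ℚ.fromℚᵘ x ℚ.+ ℚ.fromℚᵘ y))

fromℚᵘ-homo‿- : ∀ x → ℚ.fromℚᵘ (ℚᵘ.- x) ≡ ℚ.- ℚ.fromℚᵘ x
fromℚᵘ-homo‿- x = trans (ℚ.fromℚᵘ-cong (ℚᵘ.≃-sym (ℚᵘ.≃-trans
  (ℚ.toℚᵘ-homo‿- (ℚ.fromℚᵘ x)) (ℚᵘ.-‿cong (ℚ.toℚᵘ-fromℚᵘ x)))))
  (ℚ.fromℚᵘ-toℚᵘ (ℚ.- ℚ.fromℚᵘ x))

ι-* : ∀ x y → ι (x ℤ.* y) ≡ ι x ℚ.* ι y
ι-* x y = fromℚᵘ-homo-* (ℚᵘ.mkℚᵘ x 0) (ℚᵘ.mkℚᵘ y 0)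

ι-+ : ∀ x y → ι (x ℤ.+ y) ≡ ι x ℚ.+ ι y
ι-+ x y = trans (cong ι (sym (cong₂ ℤ._+_ (ℤ.*-identityʳ x) (ℤ.*-identityʳ y))))
                (fromℚᵘ-homo-+ (ℚᵘ.mkℚᵘ x 0) (ℚᵘ.mkℚᵘ y 0))

ι-neg : ∀ x → ι (ℤ.- x) ≡ ℚ.- ι x
ι-neg x = fromℚᵘ-homo‿- (ℚᵘ.mkℚᵘ x 0)

ι-injective : ∀ {x y} → ι x ≡ ι y → x ≡ y
ι-injective {x} {y} eq with ℚᵘ.≃-trans (ℚᵘ.≃-sym (ℚ.toℚᵘ-fromℚᵘ (ℚᵘ.mkℚᵘ x 0)))
                              (ℚᵘ.≃-trans (ℚ.toℚᵘ-cong eq) (ℚ.toℚᵘ-fromℚᵘ (ℚᵘ.mkℚᵘ y 0)))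
... | ℚᵘ.*≡* x*1≡y*1 = trans (sym (ℤ.*-identityʳ x)) (trans x*1≡y*1 (ℤ.*-identityʳ y))

1/m*ι[m]≡1 : ∀ m .{{_ : NonZero m}} → (1ℤ ℚ./ m) ℚ.* ι (+ m) ≡ ℚ.1ℚ
1/m*ι[m]≡1 (suc m) = trans (sym (fromℚᵘ-homo-* (ℚᵘ.mkℚᵘ 1ℤ m) (ℚᵘ.mkℚᵘ (+ suc m) 0)))
  (ℚ.fromℚᵘ-cong {ℚᵘ.mkℚᵘ 1ℤ m ℚᵘ.* ℚᵘ.mkℚᵘ (+ suc m) 0} {ℚᵘ.1ℚᵘ} (ℚᵘ.*≡* (cong +_ (identity m))))
  where
  identity : ∀ m → (1 * suc m) * 1 ≡ 1 * (suc m * 1)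
  identity = ℕ-Solver.solve-∀

ι[m]-cancelʳ : ∀ m .{{_ : NonZero m}} {x y} → x ℚ.* ι (+ m) ≡ y ℚ.* ι (+ m) → x ≡ y
ι[m]-cancelʳ m {x} {y} eq = trans (sym (undo x)) (trans (cong ((1ℤ ℚ./ m) ℚ.*_) eq) (undo y))
  where
  open +-*-Solver
  undo : ∀ z → (1ℤ ℚ./ m) ℚ.* (z ℚ.* ι (+ m)) ≡ z
  undo z = trans (solve 3 (λ i z m → i :* (z :* m) := (i :* m) :* z) refl (1ℤ ℚ./ m) z (ι (+ m)))
                 (trans (cong (ℚ._* z) (1/m*ι[m]≡1 m)) (ℚ.*-identityˡ z))

-- Denominators and divisibility in ℤ[1/P]

module Localised (P : ℕ) .{{_ : NonZero P}} where

  ιP^ : ℕ → ℚ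
  ιP^ k = ι (+ (P ^ k))

  ιP^-+ : ∀ k l → ιP^ (k + l) ≡ ιP^ k ℚ.* ιP^ l
  ιP^-+ k l = trans (cong (ι ∘ +_) (^-distribˡ-+-* P k l))
                    (trans (cong ι (ℤ.pos-* (P ^ k) (P ^ l))) (ι-* (+ (P ^ k)) (+ (P ^ l))))

  record Denominator (k : ℕ) (x : ℚ) : Set where
    constructor denominator
    field
      numerator : ℤ
      equality  : x ℚ.* ιP^ k ≡ ι numerator

  weaken : ∀ {k l x} → k ≤ l → Denominator k x → Denominator l x
  weaken {k} {l} {x} k≤l (denominator n eq) with m≤n⇒∃[o]m+o≡n k≤l
  ... | o , refl = denominator (n ℤ.* + (P ^ o)) (begin
    x ℚ.* ιP^ (k + o)          ≡⟨ cong (x ℚ.*_) (ιP^-+ k o) ⟩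
    x ℚ.* (ιP^ k ℚ.* ιP^ o)    ≡⟨ ℚ.*-assoc x (ιP^ k) (ιP^ o) ⟨
    (x ℚ.* ιP^ k) ℚ.* ιP^ o    ≡⟨ cong (ℚ._* ιP^ o) eq ⟩
    ι n ℚ.* ιP^ o              ≡⟨ ι-* n (+ (P ^ o)) ⟨
    ι (n ℤ.* + (P ^ o))        ∎)
    where open ≡-Reasoning

  common : ∀ {n} (x : Fin n → ℚ) → (∀ i → ∃[ k ] Denominator k (x i)) →
    ∃[ k ] (∀ i → Denominator k (x i))
  common {zero}  x den = 0 , λ ()
  common {suc n} x den with den 0F | common (x ∘ Fin.suc) (den ∘ Fin.suc)
  ... | k , d | l , ds = k + l , λ where
    0F          → weaken (m≤m+n k l) d
    (Fin.suc i) → weaken (m≤n+m l k) (ds i)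

  add-den : ∀ {k x y} → Denominator k x → Denominator k y → Denominator k (x ℚ.+ y)
  add-den {k} {x} {y} (denominator m eq) (denominator n eq′) = denominator (m ℤ.+ n)
    (trans (ℚ.*-distribʳ-+ (ιP^ k) x y) (trans (cong₂ ℚ._+_ eq eq′) (sym (ι-+ m n))))

  neg-den : ∀ {k x} → Denominator k x → Denominator k (ℚ.- x)
  neg-den {k} {x} (denominator m eq) = denominator (ℤ.- m)
    (trans (sym (ℚ.neg-distribˡ-* x (ιP^ k))) (trans (cong (ℚ.-_) eq) (sym (ι-neg m))))

  mul-den : ∀ {k l x y} → Denominator k x → Denominator l y → Denominator (k + l) (x ℚ.* y)
  mul-den {k} {l} {x} {y} (denominator m eq) (denominator n eq′) = denominator (m ℤ.* n) (begin
    (x ℚ.* y) ℚ.* ιP^ (k + l)             ≡⟨ cong ((x ℚ.* y) ℚ.*_) (ιP^-+ k l) ⟩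
    (x ℚ.* y) ℚ.* (ιP^ k ℚ.* ιP^ l)       ≡⟨ solve 4 (λ x y a b → (x :* y) :* (a :* b) := (x :* a) :* (y :* b)) refl x y (ιP^ k) (ιP^ l) ⟩
    (x ℚ.* ιP^ k) ℚ.* (y ℚ.* ιP^ l)       ≡⟨ cong₂ ℚ._*_ eq eq′ ⟩
    ι m ℚ.* ι n                           ≡⟨ ι-* m n ⟨
    ι (m ℤ.* n)                           ∎)
    where
    open ≡-Reasoning
    open +-*-Solver

  -- The rationals whose denominator divides a power of `P` form a subring, so they contain the
  -- subring generated by `G` once they contain `G`.
  ℤ[]-denominator : ∀ {G} → (∀ {x} → G x → ∃[ k ] Denominator k x) →
    ∀ {x} → ℤ[ G ] x → ∃[ k ] Denominator k x
  ℤ[]-denominator gen-den (gen x∈) = gen-den x∈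
  ℤ[]-denominator gen-den zero = 0 , denominator 0ℤ refl
  ℤ[]-denominator gen-den one  = 0 , denominator 1ℤ refl
  ℤ[]-denominator gen-den (add x∈ y∈) with ℤ[]-denominator gen-den x∈ | ℤ[]-denominator gen-den y∈
  ... | k , dx | l , dy = k + l , add-den (weaken (m≤m+n k l) dx) (weaken (m≤n+m l k) dy)
  ℤ[]-denominator gen-den (mul x∈ y∈) with ℤ[]-denominator gen-den x∈ | ℤ[]-denominator gen-den y∈
  ... | k , dx | l , dy = k + l , mul-den dx dy
  ℤ[]-denominator gen-den (neg x∈) with ℤ[]-denominator gen-den x∈
  ... | k , dx = k , neg-den dx

  infix 4 _⊑_

  -- Divisibility in ℤ[1/P].
  record _⊑_ (a b : ℤ) : Set where
    constructor ⊑-by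
    field
      exponent     : ℕ
      divisibility : ∣ a ∣ ∣ ∣ b ∣ * P ^ exponent

  P^k∣P^l : ∀ {k l} → k ≤ l → P ^ k ∣ P ^ l
  P^k∣P^l {k} k≤l with m≤n⇒∃[o]m+o≡n k≤l
  ... | o , refl = subst (P ^ k ∣_) (sym (^-distribˡ-+-* P k o)) (m∣m*n (P ^ o))

  ⊑-refl : ∀ {a} → a ⊑ a
  ⊑-refl = ⊑-by 0 (m∣m*n 1)

  ⊑-trans : ∀ {a b c} → a ⊑ b → b ⊑ c → a ⊑ c
  ⊑-trans {a} {b} {c} (⊑-by k a∣) (⊑-by l b∣) = ⊑-by (l + k)
    (subst (∣ a ∣ ∣_) (trans (*-assoc ∣ c ∣ (P ^ l) (P ^ k)) (cong (∣ c ∣ *_) (sym (^-distribˡ-+-* P l k))))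
      (∣-trans a∣ (*-monoˡ-∣ (P ^ k) b∣)))

  -- Both divisibilities hold with the exponent k + l, and a common factor P ^ (k + l) can be pulled
  -- out of the gcd.
  ⊑-gcd : ∀ {a b c} → a ⊑ b → a ⊑ c → a ⊑ ℤ.gcd b c
  ⊑-gcd {a} {b} {c} (⊑-by k a∣b) (⊑-by l a∣c) = ⊑-by (k + l)
    (subst (∣ a ∣ ∣_) (trans (sym (c*gcd[m,n]≡gcd[cm,cn] (P ^ (k + l)) ∣ b ∣ ∣ c ∣)) (*-comm (P ^ (k + l)) _))
      (ℕ.gcd-greatest (raise ∣ b ∣ a∣b (m≤m+n k l)) (raise ∣ c ∣ a∣c (m≤n+m l k))))
    where
    raise : ∀ b {i} → ∣ a ∣ ∣ b * P ^ i → i ≤ k + l → ∣ a ∣ ∣ P ^ (k + l) * b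
    raise b {i} a∣ i≤ = ∣-trans a∣ (subst (b * P ^ i ∣_) (*-comm b (P ^ (k + l))) (*-monoʳ-∣ b (P^k∣P^l i≤)))

  ⊑-gcd-vector : ∀ {a n} (v : Vector ℤ n) → (∀ i → a ⊑ v i) → a ⊑ gcd v
  ⊑-gcd-vector {n = zero}  v a⊑v = ⊑-by 0 (_ ∣0)
  ⊑-gcd-vector {n = suc n} v a⊑v = ⊑-gcd (a⊑v 0F) (⊑-gcd-vector (v ∘ Fin.suc) (a⊑v ∘ Fin.suc))

  ⊑-cancelʳ : ∀ g .{{_ : ℤ.NonZero g}} {a b} → a ℤ.* g ⊑ b ℤ.* g → a ⊑ b
  ⊑-cancelʳ g {a} {b} (⊑-by k ag∣bg) = ⊑-by k (*-cancelʳ-∣ ∣ g ∣ (subst₂ _∣_ (ℤ.abs-* a g)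
    (trans (cong (_* P ^ k) (ℤ.abs-* b g)) (xy∙z≈xz∙y ∣ b ∣ ∣ g ∣ (P ^ k))) ag∣bg))
    where
    xy∙z≈xz∙y : ∀ x y z → x * y * z ≡ x * z * y
    xy∙z≈xz∙y = ℕ-Solver.solve-∀

  open Denominator

  sub-den : ∀ {k x y} → Denominator k x → Denominator k y → Denominator k (x ℚ.- y)
  sub-den dx dy = add-den dx (neg-den dy)

  -- The common denominator Pᵏ cancels from both differences; the denominator Pˡ of the quotient `g`
  -- is the power of `P` that `_⊑_` allows.
  numerator-⊑ : ∀ {k x x′ y y′ g} → y ℚ.- y′ ≡ (x ℚ.- x′) ℚ.* g → ∃[ l ] Denominator l g →
    (dx : Denominator k x) (dx′ : Denominator k x′) (dy : Denominator k y) (dy′ : Denominator k y′) →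
    numerator dx ℤ.- numerator dx′ ⊑ numerator dy ℤ.- numerator dy′
  numerator-⊑ {k} {x} {x′} {y} {y′} {g} eq (l , dg) dx dx′ dy dy′ =
    ⊑-by l (subst (∣ numerator dx ℤ.- numerator dx′ ∣ ∣_) (ℤ.abs-* (numerator dy ℤ.- numerator dy′) (+ (P ^ l)))
          (ℤ.∣⇒∣ᵤ {i = (numerator dy ℤ.- numerator dy′) ℤ.* + (P ^ l)} (ℤ.divides (numerator dg) (ι-injective (begin
      ι ((numerator dy ℤ.- numerator dy′) ℤ.* + (P ^ l))
        ≡⟨ ι-* (numerator dy ℤ.- numerator dy′) (+ (P ^ l)) ⟩
      ι (numerator dy ℤ.- numerator dy′) ℚ.* ιP^ l
        ≡⟨ cong (ℚ._* ιP^ l) (equality (sub-den dy dy′)) ⟨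
      (y ℚ.- y′) ℚ.* ιP^ k ℚ.* ιP^ l
        ≡⟨ cong (λ z → z ℚ.* ιP^ k ℚ.* ιP^ l) eq ⟩
      (x ℚ.- x′) ℚ.* g ℚ.* ιP^ k ℚ.* ιP^ l
        ≡⟨ solve 4 (λ d g a b → d :* g :* a :* b := (g :* b) :* (d :* a)) refl (x ℚ.- x′) g (ιP^ k) (ιP^ l) ⟩
      (g ℚ.* ιP^ l) ℚ.* ((x ℚ.- x′) ℚ.* ιP^ k)
        ≡⟨ cong₂ ℚ._*_ (equality dg) (equality (sub-den dx dx′)) ⟩
      ι (numerator dg) ℚ.* ι (numerator dx ℤ.- numerator dx′)
        ≡⟨ ι-* (numerator dg) (numerator dx ℤ.- numerator dx′) ⟨
      ι (numerator dg ℤ.* (numerator dx ℤ.- numerator dx′)) ∎)))))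
    where
    open ≡-Reasoning
    open +-*-Solver

  numerator-≢ : ∀ {k x y} → x ≢ y → (dx : Denominator k x) (dy : Denominator k y) →
    numerator dx ≢ numerator dy
  numerator-≢ {k} x≢y dx dy eq = x≢y (ι[m]-cancelʳ (P ^ k) {{m^n≢0 P k}}
    (trans (equality dx) (trans (cong ι eq) (sym (equality dy)))))

  inverse-denominator : ∀ m n .{{_ : NonZero m}} → P ≡ m * n → Denominator 1 (1ℤ ℚ./ m)
  inverse-denominator m n refl = denominator (+ n) (begin
    (1ℤ ℚ./ m) ℚ.* ι (+ (m * n * 1))            ≡⟨ cong (λ z → (1ℤ ℚ./ m) ℚ.* ι (+ z)) (*-identityʳ (m * n)) ⟩
    (1ℤ ℚ./ m) ℚ.* ι (+ (m * n))                ≡⟨ cong (λ z → (1ℤ ℚ./ m) ℚ.* ι z) (ℤ.pos-* m n) ⟩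
    (1ℤ ℚ./ m) ℚ.* ι (+ m ℤ.* + n)              ≡⟨ cong ((1ℤ ℚ./ m) ℚ.*_) (ι-* (+ m) (+ n)) ⟩
    (1ℤ ℚ./ m) ℚ.* (ι (+ m) ℚ.* ι (+ n))        ≡⟨ ℚ.*-assoc (1ℤ ℚ./ m) (ι (+ m)) (ι (+ n)) ⟨
    (1ℤ ℚ./ m) ℚ.* ι (+ m) ℚ.* ι (+ n)          ≡⟨ cong (ℚ._* ι (+ n)) (1/m*ι[m]≡1 m) ⟩
    ℚ.1ℚ ℚ.* ι (+ n)                            ≡⟨ ℚ.*-identityˡ (ι (+ n)) ⟩
    ι (+ n)                                     ∎)
    where open ≡-Reasoning

-- From 4-cycles to unit equations

next : Fin 4 → Fin 4
next 0F = 1F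
next 1F = 2F
next 2F = 3F
next 3F = 0F

Has4Cycle⇒points : ∀ {G} → Has4Cycle (adjoin G) →
  Σ[ f ∈ Polynomial (adjoin G) ] Σ[ x ∈ (Fin 4 → Σ ℚ ℤ[ G ]) ]
    (∀ i j → i ≢ j → proj₁ (x i) ≢ proj₁ (x j)) ×
    (∀ i → proj₁ (eval (adjoin G) f (x i)) ≡ proj₁ (x (next i)))
Has4Cycle⇒points (f , x₁ , x₂ , x₃ , x₄ , record
  { distinct = (1≢2 ∷ 1≢3 ∷ 1≢4 ∷ []) ∷ (2≢3 ∷ 2≢4 ∷ []) ∷ (3≢4 ∷ []) ∷ [] ∷ []
  ; f[x₁]≈x₂ = f₁ ; f[x₂]≈x₃ = f₂ ; f[x₃]≈x₄ = f₃ ; f[x₄]≈x₁ = f₄ }) =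
  f , lookup (x₁ ∷ x₂ ∷ x₃ ∷ x₄ ∷ []) , distinct , λ { 0F → f₁ ; 1F → f₂ ; 2F → f₃ ; 3F → f₄ }
  where
  distinct : ∀ i j → i ≢ j → proj₁ (lookup (x₁ ∷ x₂ ∷ x₃ ∷ x₄ ∷ []) i) ≢ proj₁ (lookup (x₁ ∷ x₂ ∷ x₃ ∷ x₄ ∷ []) j)
  distinct 0F 0F i≢i = contradiction refl i≢i
  distinct 0F 1F _   = 1≢2
  distinct 0F 2F _   = 1≢3
  distinct 0F 3F _   = 1≢4
  distinct 1F 0F _   = 1≢2 ∘ sym
  distinct 1F 1F i≢i = contradiction refl i≢i
  distinct 1F 2F _   = 2≢3
  distinct 1F 3F _   = 2≢4
  distinct 2F 0F _   = 1≢3 ∘ sym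
  distinct 2F 1F _   = 2≢3 ∘ sym
  distinct 2F 2F i≢i = contradiction refl i≢i
  distinct 2F 3F _   = 3≢4
  distinct 3F 0F _   = 1≢4 ∘ sym
  distinct 3F 1F _   = 2≢4 ∘ sym
  distinct 3F 2F _   = 3≢4 ∘ sym
  distinct 3F 3F i≢i = contradiction refl i≢i

i-j≢0 : ∀ {i j} → i ≢ j → i ℤ.- j ≢ 0ℤ
i-j≢0 i≢j eq = i≢j (ℤ.i-j≡0⇒i≡j _ _ eq)

i*j≡0∧j≢0⇒i≡0 : ∀ i {j} → j ≢ 0ℤ → i ℤ.* j ≡ 0ℤ → i ≡ 0ℤ
i*j≡0∧j≢0⇒i≡0 i j≢0 eq with ℤ.i*j≡0⇒i≡0∨j≡0 i eq
... | inj₁ i≡0 = i≡0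
... | inj₂ j≡0 = contradiction j≡0 j≢0

-- The product of gcd v and gcd w divides every entry of w, hence gcd w. The nonzero entry makes gcd
-- w nonzero, so it cancels.
gcd-normalise : (w : Vector ℤ (suc n)) → w 0F ≢ 0ℤ →
  ∃[ g ] Σ[ v ∈ Vector ℤ (suc n) ] g ≢ 0ℤ × (∀ i → w i ≡ v i ℤ.* g) × gcd v ≡ 1ℤ
gcd-normalise w w₀≢0 = gcd w , v , g≢0 , w≡ , cong +_ (∣1⇒≡1 ∣gcd[v]∣∣1)
  where
  signed : ∀ i → gcd w ℤ.∣ w i
  signed i = ℤ.∣ᵤ⇒∣ (∣gcd∣ w i)
  v : Vector ℤ _
  v i = ℤ._∣_.quotient (signed i)
  w≡ : ∀ i → w i ≡ v i ℤ.* gcd w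
  w≡ i = ℤ._∣_.equality (signed i)
  g≢0 : gcd w ≢ 0ℤ
  g≢0 g≡0 = w₀≢0 (trans (w≡ 0F) (trans (cong (v 0F ℤ.*_) g≡0) (ℤ.*-zeroʳ (v 0F))))
  ∣gcd[v]∣∣1 : ∣ gcd v ∣ ∣ 1
  ∣gcd[v]∣∣1 = *-cancelʳ-∣ ∣ gcd w ∣ {{ℕ.≢-nonZero (g≢0 ∘ ℤ.∣i∣≡0⇒i≡0)}}
    (subst (∣ gcd v ∣ * ∣ gcd w ∣ ∣_) (sym (*-identityˡ ∣ gcd w ∣)) (gcd-greatest w λ i →
      subst (∣ gcd v ∣ * ∣ gcd w ∣ ∣_) (sym (trans (cong ∣_∣ (w≡ i)) (ℤ.abs-* (v i) (gcd w))))
        (*-monoˡ-∣ ∣ gcd w ∣ (∣gcd∣ v i))))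

-- The normalised differences of consecutive points of a 4-cycle.
record UnitEquation (P : ℕ) .{{_ : NonZero P}} : Set where
  open Localised P
  field
    v        : Vector ℤ 4
    ∑v≡0     : ∑ v ≡ 0ℤ
    gcd≡1    : gcd v ≡ 1ℤ
    v≢0      : ∀ i → v i ≢ 0ℤ
    v₀+v₁≢0  : v 0F ℤ.+ v 1F ≢ 0ℤ
    v₁+v₂≢0  : v 1F ℤ.+ v 2F ≢ 0ℤ
    v⊑v      : ∀ i → v i ⊑ v (next i)
    v₀+v₁⊑   : v 0F ℤ.+ v 1F ⊑ v 1F ℤ.+ v 2F
    v₁+v₂⊑   : v 1F ℤ.+ v 2F ⊑ v 2F ℤ.+ v 3F

module _ {P : ℕ} .{{_ : NonZero P}} where
  open Localised P
  open Denominator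

  -- Applying f sends a difference of points to a multiple of it, so each difference along the cycle
  -- divides its successor. Clearing a common denominator and then dividing by the gcd preserves
  -- these relations.
  Has4Cycle⇒UnitEquation : ∀ {G} → (∀ {x} → G x → ∃[ k ] Denominator k x) →
    Has4Cycle (adjoin G) → UnitEquation P
  Has4Cycle⇒UnitEquation {G} gen-den cycle
    with f , x , x-distinct , f[x]≡ ← Has4Cycle⇒points cycle
    with K , d ← common (proj₁ ∘ x) (λ i → ℤ[]-denominator gen-den (proj₂ (x i)))
    = record
    { v       = v
    ; ∑v≡0    = i*j≡0∧j≢0⇒i≡0 (∑ v) g≢0 (trans (distrib₄ (v 0F) (v 1F) (v 2F) (v 3F) g)
                  (trans (cong₄ (sym (w≡ 0F)) (sym (w≡ 1F)) (sym (w≡ 2F)) (sym (w≡ 3F)))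
                         (telescope (X 0F) (X 1F) (X 2F) (X 3F))))
    ; gcd≡1   = gcd≡1
    ; v≢0     = λ i v≡0 → w≢0 i (trans (w≡ i) (cong (ℤ._* g) v≡0))
    -- Consecutive differences telescope: up to the factor `g`, the two sums are the differences of
    -- opposite points of the cycle.
    ; v₀+v₁≢0 = λ eq → i-j≢0 (X-distinct 2F 0F λ ()) (trans (sym (sum₂ 0F)) (cong (ℤ._* g) eq))
    ; v₁+v₂≢0 = λ eq → i-j≢0 (X-distinct 3F 1F λ ()) (trans (sym (sum₂ 1F)) (cong (ℤ._* g) eq))
    ; v⊑v     = λ i → ⊑-cancelʳ g (subst₂ _⊑_ (w≡ i) (w≡ (next i)) (step (next i) i))
    ; v₀+v₁⊑  = ⊑-cancelʳ g (subst₂ _⊑_ (sym (sum₂ 0F)) (sym (sum₂ 1F)) (step 2F 0F))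
    -- Here f carries the opposite pair (3, 1) to (0, 2), whose difference telescopes from the last
    -- two entries.
    ; v₁+v₂⊑  = ⊑-cancelʳ g (subst₂ _⊑_ (sym (sum₂ 1F)) (sym (sum₂ 2F)) (step 3F 1F))
    }
    where
    X : Vector ℤ 4
    X i = numerator (d i)

    X-distinct : ∀ i j → i ≢ j → X i ≢ X j
    X-distinct i j i≢j = numerator-≢ (x-distinct i j i≢j) (d i) (d j)

    step : ∀ i j → X i ℤ.- X j ⊑ X (next i) ℤ.- X (next j)
    step i j with g , eq ← x-y∣f[x]-f[y] G f (x i) (x j) =
      numerator-⊑ (trans (sym (cong₂ ℚ._-_ (f[x]≡ i) (f[x]≡ j))) eq)
        (ℤ[]-denominator gen-den (proj₂ g)) (d i) (d j) (d (next i)) (d (next j))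

    next-≢ : ∀ i → next i ≢ i
    next-≢ 0F ()
    next-≢ 1F ()
    next-≢ 2F ()
    next-≢ 3F ()

    w : Vector ℤ 4
    w i = X (next i) ℤ.- X i

    w≢0 : ∀ i → w i ≢ 0ℤ
    w≢0 i = i-j≢0 (X-distinct (next i) i (next-≢ i))

    normalised = gcd-normalise w (w≢0 0F)
    g     = proj₁ normalised
    v     = proj₁ (proj₂ normalised)
    g≢0   = proj₁ (proj₂ (proj₂ normalised))
    w≡    = proj₁ (proj₂ (proj₂ (proj₂ normalised)))
    gcd≡1 = proj₂ (proj₂ (proj₂ (proj₂ normalised)))
    instance
      g-nonZero : ℤ.NonZero g
      g-nonZero = ℤ.≢-nonZero g≢0

    distrib₄ : ∀ a b c e g → (a ℤ.+ (b ℤ.+ (c ℤ.+ (e ℤ.+ 0ℤ)))) ℤ.* g ≡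
      a ℤ.* g ℤ.+ (b ℤ.* g ℤ.+ (c ℤ.* g ℤ.+ (e ℤ.* g ℤ.+ 0ℤ)))
    distrib₄ = ℤ-Solver.solve-∀

    cong₄ : ∀ {a b c e a′ b′ c′ e′} → a ≡ a′ → b ≡ b′ → c ≡ c′ → e ≡ e′ →
      a ℤ.+ (b ℤ.+ (c ℤ.+ (e ℤ.+ 0ℤ))) ≡ a′ ℤ.+ (b′ ℤ.+ (c′ ℤ.+ (e′ ℤ.+ 0ℤ)))
    cong₄ refl refl refl refl = refl

    telescope : ∀ a b c e →
      (b ℤ.- a) ℤ.+ ((c ℤ.- b) ℤ.+ ((e ℤ.- c) ℤ.+ ((a ℤ.- e) ℤ.+ 0ℤ))) ≡ 0ℤ
    telescope = ℤ-Solver.solve-∀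

    sum₂ : ∀ i → (v i ℤ.+ v (next i)) ℤ.* g ≡ X (next (next i)) ℤ.- X i
    sum₂ i = trans (ℤ.*-distribʳ-+ g (v i) (v (next i)))
      (trans (cong₂ ℤ._+_ (sym (w≡ i)) (sym (w≡ (next i))))
             (collapse (X i) (X (next i)) (X (next (next i)))))
      where
      collapse : ∀ a b c → (b ℤ.- a) ℤ.+ (c ℤ.- b) ≡ c ℤ.- a
      collapse = ℤ-Solver.solve-∀

-- Four-term unit equations

-- As the total is zero, a subset and its complement have zero sum together. Up to complement only
-- the singletons and three pairs remain.
noVanishingSubsum₄ : (v : Vector ℤ 4) → ∑ v ≡ 0ℤ → (∀ i → v i ≢ 0ℤ) →
  v 0F ℤ.+ v 1F ≢ 0ℤ → v 1F ℤ.+ v 2F ≢ 0ℤ → v 0F ℤ.+ v 2F ≢ 0ℤ → NoVanishingSubsum v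
noVanishingSubsum₄ v ∑≡0 v≢0 ab≢0 bc≢0 ac≢0 = cases
  where
  v₀ = v 0F
  v₁ = v 1F
  v₂ = v 2F
  v₃ = v 3F
  by : ∀ {x s} → x ≢ 0ℤ → x ≡ s → s ≢ 0ℤ
  by x≢0 x≡s s≡0 = x≢0 (trans x≡s s≡0)
  by-∁ : ∀ {x s} → x ≢ 0ℤ → x ≡ ∑ v ℤ.- s → s ≢ 0ℤ
  by-∁ x≢0 x≡∑-s s≡0 = x≢0 (trans x≡∑-s (cong₂ ℤ._-_ ∑≡0 s≡0))
  cases : NoVanishingSubsum v
  cases (true  ∷ true  ∷ true  ∷ true  ∷ []) _ (_ , i , _ , i∉⊤) = contradiction Subset.∈⊤ i∉⊤
  cases (false ∷ false ∷ false ∷ false ∷ []) (i , i∈⊥) _ = contradiction i∈⊥ (Subset.∉⊥ {x = i})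
  cases (true  ∷ false ∷ false ∷ false ∷ []) _ _ = by (v≢0 0F) (eq v₀)
    where eq : ∀ a → a ≡ a ℤ.+ (0ℤ ℤ.+ (0ℤ ℤ.+ (0ℤ ℤ.+ 0ℤ)))
          eq = ℤ-Solver.solve-∀
  cases (false ∷ true  ∷ false ∷ false ∷ []) _ _ = by (v≢0 1F) (eq v₁)
    where eq : ∀ b → b ≡ 0ℤ ℤ.+ (b ℤ.+ (0ℤ ℤ.+ (0ℤ ℤ.+ 0ℤ)))
          eq = ℤ-Solver.solve-∀
  cases (false ∷ false ∷ true  ∷ false ∷ []) _ _ = by (v≢0 2F) (eq v₂)
    where eq : ∀ c → c ≡ 0ℤ ℤ.+ (0ℤ ℤ.+ (c ℤ.+ (0ℤ ℤ.+ 0ℤ)))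
          eq = ℤ-Solver.solve-∀
  cases (false ∷ false ∷ false ∷ true  ∷ []) _ _ = by (v≢0 3F) (eq v₃)
    where eq : ∀ e → e ≡ 0ℤ ℤ.+ (0ℤ ℤ.+ (0ℤ ℤ.+ (e ℤ.+ 0ℤ)))
          eq = ℤ-Solver.solve-∀
  cases (true  ∷ true  ∷ false ∷ false ∷ []) _ _ = by ab≢0 (eq v₀ v₁)
    where eq : ∀ a b → a ℤ.+ b ≡ a ℤ.+ (b ℤ.+ (0ℤ ℤ.+ (0ℤ ℤ.+ 0ℤ)))
          eq = ℤ-Solver.solve-∀
  cases (true  ∷ false ∷ true  ∷ false ∷ []) _ _ = by ac≢0 (eq v₀ v₂)
    where eq : ∀ a c → a ℤ.+ c ≡ a ℤ.+ (0ℤ ℤ.+ (c ℤ.+ (0ℤ ℤ.+ 0ℤ)))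
          eq = ℤ-Solver.solve-∀
  cases (false ∷ true  ∷ true  ∷ false ∷ []) _ _ = by bc≢0 (eq v₁ v₂)
    where eq : ∀ b c → b ℤ.+ c ≡ 0ℤ ℤ.+ (b ℤ.+ (c ℤ.+ (0ℤ ℤ.+ 0ℤ)))
          eq = ℤ-Solver.solve-∀
  cases (false ∷ false ∷ true  ∷ true  ∷ []) _ _ = by-∁ ab≢0 (eq v₀ v₁ v₂ v₃)
    where eq : ∀ a b c e → a ℤ.+ b ≡ (a ℤ.+ (b ℤ.+ (c ℤ.+ (e ℤ.+ 0ℤ)))) ℤ.- (0ℤ ℤ.+ (0ℤ ℤ.+ (c ℤ.+ (e ℤ.+ 0ℤ))))
          eq = ℤ-Solver.solve-∀
  cases (false ∷ true  ∷ false ∷ true  ∷ []) _ _ = by-∁ ac≢0 (eq v₀ v₁ v₂ v₃)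
    where eq : ∀ a b c e → a ℤ.+ c ≡ (a ℤ.+ (b ℤ.+ (c ℤ.+ (e ℤ.+ 0ℤ)))) ℤ.- (0ℤ ℤ.+ (b ℤ.+ (0ℤ ℤ.+ (e ℤ.+ 0ℤ))))
          eq = ℤ-Solver.solve-∀
  cases (true  ∷ false ∷ false ∷ true  ∷ []) _ _ = by-∁ bc≢0 (eq v₀ v₁ v₂ v₃)
    where eq : ∀ a b c e → b ℤ.+ c ≡ (a ℤ.+ (b ℤ.+ (c ℤ.+ (e ℤ.+ 0ℤ)))) ℤ.- (a ℤ.+ (0ℤ ℤ.+ (0ℤ ℤ.+ (e ℤ.+ 0ℤ))))
          eq = ℤ-Solver.solve-∀
  cases (false ∷ true  ∷ true  ∷ true  ∷ []) _ _ = by-∁ (v≢0 0F) (eq v₀ v₁ v₂ v₃)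
    where eq : ∀ a b c e → a ≡ (a ℤ.+ (b ℤ.+ (c ℤ.+ (e ℤ.+ 0ℤ)))) ℤ.- (0ℤ ℤ.+ (b ℤ.+ (c ℤ.+ (e ℤ.+ 0ℤ))))
          eq = ℤ-Solver.solve-∀
  cases (true  ∷ false ∷ true  ∷ true  ∷ []) _ _ = by-∁ (v≢0 1F) (eq v₀ v₁ v₂ v₃)
    where eq : ∀ a b c e → b ≡ (a ℤ.+ (b ℤ.+ (c ℤ.+ (e ℤ.+ 0ℤ)))) ℤ.- (a ℤ.+ (0ℤ ℤ.+ (c ℤ.+ (e ℤ.+ 0ℤ))))
          eq = ℤ-Solver.solve-∀
  cases (true  ∷ true  ∷ false ∷ true  ∷ []) _ _ = by-∁ (v≢0 2F) (eq v₀ v₁ v₂ v₃)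
    where eq : ∀ a b c e → c ≡ (a ℤ.+ (b ℤ.+ (c ℤ.+ (e ℤ.+ 0ℤ)))) ℤ.- (a ℤ.+ (b ℤ.+ (0ℤ ℤ.+ (e ℤ.+ 0ℤ))))
          eq = ℤ-Solver.solve-∀
  cases (true  ∷ true  ∷ true  ∷ false ∷ []) _ _ = by-∁ (v≢0 3F) (eq v₀ v₁ v₂ v₃)
    where eq : ∀ a b c e → e ≡ (a ℤ.+ (b ℤ.+ (c ℤ.+ (e ℤ.+ 0ℤ)))) ℤ.- (a ℤ.+ (b ℤ.+ (c ℤ.+ (0ℤ ℤ.+ 0ℤ))))
          eq = ℤ-Solver.solve-∀

-- The two nonvanishing sums force a = b = c, and 3a + e is ±2 or ±4.
signs-sum-≢0 : ∀ a b c e → ∣ a ∣ ≡ 1 → ∣ b ∣ ≡ 1 → ∣ c ∣ ≡ 1 → ∣ e ∣ ≡ 1 →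
  a ℤ.+ b ≢ 0ℤ → a ℤ.+ c ≢ 0ℤ → a ℤ.+ (b ℤ.+ (c ℤ.+ (e ℤ.+ 0ℤ))) ≢ 0ℤ
signs-sum-≢0 (+ _)    (+ _)    (+ _)    (+ _)    refl refl refl refl _  _  ()
signs-sum-≢0 (+ _)    (+ _)    (+ _)    -[1+ _ ] refl refl refl refl _  _  ()
signs-sum-≢0 (+ _)    (+ _)    -[1+ _ ] _        refl refl refl _    _  ac _ = ac refl
signs-sum-≢0 (+ _)    -[1+ _ ] _        _        refl refl _    _    ab _  _ = ab refl
signs-sum-≢0 -[1+ _ ] (+ _)    _        _        refl refl _    _    ab _  _ = ab refl
signs-sum-≢0 -[1+ _ ] -[1+ _ ] (+ _)    _        refl refl refl _    _  ac _ = ac refl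
signs-sum-≢0 -[1+ _ ] -[1+ _ ] -[1+ _ ] (+ _)    refl refl refl refl _  _  ()
signs-sum-≢0 -[1+ _ ] -[1+ _ ] -[1+ _ ] -[1+ _ ] refl refl refl refl _  _  ()

-- Parity and units in ℤ[1/P]

halve : ∀ x → ∃[ h ] (x ≡ h ℤ.* + 2 ⊎ x ≡ 1ℤ ℤ.+ h ℤ.* + 2)
halve x = (x ℤ./ + 2) , cases (x ℤ.% + 2) {x ℤ./ + 2} (n%d<d x (+ 2)) (a≡a%n+[a/n]*n x (+ 2))
  where
  cases : ∀ r {h} → r < 2 → x ≡ + r ℤ.+ h ℤ.* + 2 → x ≡ h ℤ.* + 2 ⊎ x ≡ 1ℤ ℤ.+ h ℤ.* + 2
  cases 0 _ eq = inj₁ (trans eq (ℤ.+-identityˡ _))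
  cases 1 _ eq = inj₂ eq
  cases (suc (suc _)) (s≤s (s≤s ())) _

odd+odd : ∀ x y → ¬ 2 ∣ ∣ x ∣ → ¬ 2 ∣ ∣ y ∣ → + 2 ℤ.∣ x ℤ.+ y
odd+odd x y x-odd y-odd with halve x | halve y
... | h , inj₁ eq | _ = contradiction (ℤ.∣⇒∣ᵤ (ℤ.divides h eq)) x-odd
... | _ | h , inj₁ eq = contradiction (ℤ.∣⇒∣ᵤ (ℤ.divides h eq)) y-odd
... | h , inj₂ refl | h′ , inj₂ refl = ℤ.divides (1ℤ ℤ.+ (h ℤ.+ h′)) (regroup h h′)
  where
  regroup : ∀ h h′ → (1ℤ ℤ.+ h ℤ.* + 2) ℤ.+ (1ℤ ℤ.+ h′ ℤ.* + 2) ≡ (1ℤ ℤ.+ (h ℤ.+ h′)) ℤ.* + 2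
  regroup = ℤ-Solver.solve-∀

module _ (P : ℕ) .{{_ : NonZero P}} where
  open Localised P

  -- For odd `P` the prime 2 is not inverted, so evenness still passes from divisors to multiples.
  odd-⊑ : ¬ 2 ∣ P → ∀ {a b} → a ⊑ b → 2 ∣ ∣ a ∣ → 2 ∣ ∣ b ∣
  odd-⊑ P-odd {b = b} (⊑-by k a∣) 2∣a with euclidsLemma ∣ b ∣ (P ^ k) prime[2] (∣-trans 2∣a a∣)
  ... | inj₁ 2∣b   = 2∣b
  ... | inj₂ 2∣P^k = contradiction (prime∣^⇒∣ prime[2] k 2∣P^k) P-odd

  -- (a + b) / 2 and (b - a) / 2 add up to the odd number b, so exactly one of them
  -- is even.
  ¬associated : ¬ 2 ∣ P → ∀ a b → ¬ 2 ∣ ∣ a ∣ → ¬ 2 ∣ ∣ b ∣ →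
    a ℤ.+ b ⊑ b ℤ.- a → ¬ b ℤ.- a ⊑ a ℤ.+ b
  ¬associated P-odd a b a-odd b-odd a+b⊑b-a b-a⊑a+b
    with ℤ.divides s eqₛ ← odd+odd a b a-odd b-odd
    with ℤ.divides t eqₜ ← odd+odd b (ℤ.- a) b-odd (a-odd ∘ subst (2 ∣_) (ℤ.∣-i∣≡∣i∣ a))
    -- Numbers `s` and `t` dividing each other have the same parity, so their sum b would be even in
    -- either case.
    = case 2 ∣? ∣ s ∣ of λ where
        (yes 2∣s) → b-odd (2∣b (ℤ.∣m∣n⇒∣m+n {m = s} {t} (ℤ.∣ᵤ⇒∣ 2∣s) (ℤ.∣ᵤ⇒∣ (odd-⊑ P-odd s⊑t 2∣s))))
        (no  2∤s) → b-odd (2∣b (odd+odd s t 2∤s (2∤s ∘ odd-⊑ P-odd t⊑s)))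
    where
    s⊑t : s ⊑ t
    s⊑t = ⊑-cancelʳ (+ 2) (subst₂ _⊑_ eqₛ eqₜ a+b⊑b-a)
    t⊑s : t ⊑ s
    t⊑s = ⊑-cancelʳ (+ 2) (subst₂ _⊑_ eqₜ eqₛ b-a⊑a+b)
    2∣b : + 2 ℤ.∣ s ℤ.+ t → 2 ∣ ∣ b ∣
    2∣b 2∣s+t = subst (λ z → 2 ∣ ∣ z ∣) s+t≡b (ℤ.∣⇒∣ᵤ 2∣s+t)
      where
      double : ∀ a b → (a ℤ.+ b) ℤ.+ (b ℤ.- a) ≡ b ℤ.* + 2
      double = ℤ-Solver.solve-∀
      s+t≡b : s ℤ.+ t ≡ b
      s+t≡b = ℤ.*-cancelʳ-≡ _ _ (+ 2) (trans (ℤ.*-distribʳ-+ (+ 2) s t)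
        (trans (sym (cong₂ ℤ._+_ eqₛ eqₜ)) (double a b)))

  common-exponent : (v : Vector ℤ n) → (∀ i → v i ⊑ 1ℤ) → ∃[ k ] (∀ i → ∣ v i ∣ ∣ P ^ k)
  common-exponent {zero}  v v⊑1 = 0 , λ ()
  common-exponent {suc n} v v⊑1 with v⊑1 0F | common-exponent (v ∘ Fin.suc) (v⊑1 ∘ Fin.suc)
  ... | ⊑-by k v₀∣ | l , v∣ = k + l , λ where
    0F          → ∣-trans (subst (∣ v 0F ∣ ∣_) (*-identityˡ (P ^ k)) v₀∣) (P^k∣P^l (m≤m+n k l))
    (Fin.suc i) → ∣-trans (v∣ i) (P^k∣P^l (m≤n+m l k))

  module _ (E : UnitEquation P) where
    open UnitEquation E

    v⊑v₀ : ∀ i → v i ⊑ v 0F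
    v⊑v₀ 0F = ⊑-refl
    v⊑v₀ 1F = ⊑-trans (v⊑v 1F) (⊑-trans (v⊑v 2F) (v⊑v 3F))
    v⊑v₀ 2F = ⊑-trans (v⊑v 2F) (v⊑v 3F)
    v⊑v₀ 3F = v⊑v 3F

    v₀⊑v : ∀ i → v 0F ⊑ v i
    v₀⊑v 0F = ⊑-refl
    v₀⊑v 1F = v⊑v 0F
    v₀⊑v 2F = ⊑-trans (v⊑v 0F) (v⊑v 1F)
    v₀⊑v 3F = ⊑-trans (v⊑v 0F) (⊑-trans (v⊑v 1F) (v⊑v 2F))

    -- Divisibility round the cycle makes the entries associated. Each therefore divides the gcd of
    -- all of them, which is 1, and is a unit of ℤ[1/P].
    v⊑1 : ∀ i → v i ⊑ 1ℤ
    v⊑1 i = subst (v i ⊑_) gcd≡1 (⊑-gcd-vector v (λ j → ⊑-trans (v⊑v₀ i) (v₀⊑v j)))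

    v-odd : ¬ 2 ∣ P → ∀ i → ¬ 2 ∣ ∣ v i ∣
    v-odd P-odd i 2∣vᵢ = prime∤1 prime[2] (odd-⊑ P-odd (v⊑1 i) 2∣vᵢ)

    -- If v₂ = - v₀, then v₁ + v₂ = v₁ - v₀ and v₂ + v₃ = - (v₀ + v₁), so the relations between the
    -- pair sums make v₀ + v₁ and v₁ - v₀ associated, contradicting `¬associated`.
    v₀+v₂≢0 : ¬ 2 ∣ P → v 0F ℤ.+ v 2F ≢ 0ℤ
    v₀+v₂≢0 P-odd eq = ¬associated P-odd (v 0F) (v 1F) (v-odd P-odd 0F) (v-odd P-odd 1F)
      (subst (v 0F ℤ.+ v 1F ⊑_) v₁+v₂≡ v₀+v₁⊑)
      (⊑-negʳ (subst₂ _⊑_ v₁+v₂≡ v₂+v₃≡ v₁+v₂⊑))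
      where
      ⊑-negʳ : ∀ {a b} → a ⊑ ℤ.- b → a ⊑ b
      ⊑-negʳ {a} {b} (⊑-by k a∣) = ⊑-by k (subst (λ z → ∣ a ∣ ∣ z * P ^ k) (ℤ.∣-i∣≡∣i∣ b) a∣)
      move : ∀ a b c → b ℤ.+ c ≡ (b ℤ.- a) ℤ.+ (a ℤ.+ c)
      move = ℤ-Solver.solve-∀
      v₁+v₂≡ : v 1F ℤ.+ v 2F ≡ v 1F ℤ.- v 0F
      v₁+v₂≡ = trans (move (v 0F) (v 1F) (v 2F)) (trans (cong (λ z → (v 1F ℤ.- v 0F) ℤ.+ z) eq) (ℤ.+-identityʳ _))
      complement : ∀ a b c e → c ℤ.+ e ≡ ℤ.- (a ℤ.+ b) ℤ.+ (a ℤ.+ (b ℤ.+ (c ℤ.+ (e ℤ.+ 0ℤ))))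
      complement = ℤ-Solver.solve-∀
      v₂+v₃≡ : v 2F ℤ.+ v 3F ≡ ℤ.- (v 0F ℤ.+ v 1F)
      v₂+v₃≡ = trans (complement (v 0F) (v 1F) (v 2F) (v 3F))
        (trans (cong (λ z → ℤ.- (v 0F ℤ.+ v 1F) ℤ.+ z) ∑v≡0) (ℤ.+-identityʳ _))

-- The case n = 4, ε = 1 of the conjecture, with exponent 2 · 4 − 5 + 1 = 4.
ConjecturalBound : ℕ → Set
ConjecturalBound C = ∀ (v : Vector ℤ 4) → ∑ v ≡ 0ℤ → NoVanishingSubsum v → gcd v ≡ 1ℤ →
  max∣ v ∣ ≤ C * rad (∏ v) ^ 4

conjecturalBound : BrowkinBrzezinskiConjecture → ∃ ConjecturalBound
conjecturalBound conjecture =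
  let C , bound = conjecture 4 (s≤s (s≤s (s≤s z≤n))) ℚ.1ℚ (ℚ.positive⁻¹ ℚ.1ℚ)
  in C , λ v ∑≡0 noSub gcd≡1 →
    -- The exponent is 4 / 1, so the conjectured inequality is raised to the power 1; the trivial
    -- exponents are removed.
    subst₂ _≤_ (*-identityʳ _) (cong (_* rad (∏ v) ^ 4) (*-identityʳ C)) (bound v ∑≡0 noSub gcd≡1)

-- ∣ vᵢ ∣ ≤ C rad⁴ ≤ L (L² L²)⁴ = L¹⁷.
¬unitEquation : ∀ {C L} → ConjecturalBound C → C ≤ L → 4 ≤ L → (pair : PrimePair 4 17 L) →
  let open PrimePair pair in .{{_ : NonZero (p₁ * p₂)}} → ¬ UnitEquation (p₁ * p₂)
¬unitEquation {C} {L} bound C≤L 4≤L pair E =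
  signs-sum-≢0 (v 0F) (v 1F) (v 2F) (v 3F) (v≡1 0F) (v≡1 1F) (v≡1 2F) (v≡1 3F)
    v₀+v₁≢0 (v₀+v₂≢0 P E P-odd) ∑v≡0
  where
  open PrimePair pair
  open UnitEquation E
  P = p₁ * p₂

  odd : ∀ {p} → Prime p → L < p → ¬ 2 ∣ p
  odd p-prime L<p 2∣p = contradiction (subst (4 <_) (sym (prime∣prime⇒≡ prime[2] p-prime 2∣p)) (≤-<-trans 4≤L L<p))
    λ { (s≤s (s≤s ())) }

  P-odd : ¬ 2 ∣ P
  P-odd 2∣P = Sum⊎.[ odd p₁-prime L<p₁ , odd p₂-prime L<p₂ ] (euclidsLemma p₁ p₂ prime[2] 2∣P)

  noSub : NoVanishingSubsum v
  noSub = noVanishingSubsum₄ v ∑v≡0 v≢0 v₀+v₁≢0 v₁+v₂≢0 (v₀+v₂≢0 P E P-odd)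

  exponent : ℕ
  exponent = proj₁ (common-exponent P v (v⊑1 P E))

  v∣P^k : ∀ i → ∣ v i ∣ ∣ P ^ exponent
  v∣P^k = proj₂ (common-exponent P v (v⊑1 P E))

  v< : ∀ i → ∣ v i ∣ < p₁ ^ 17
  v< i = begin-strict
    ∣ v i ∣              ≤⟨ ∣v∣≤max v i ⟩
    max∣ v ∣             ≤⟨ bound v ∑v≡0 noSub gcd≡1 ⟩
    C * rad (∏ v) ^ 4    ≤⟨ *-mono-≤ C≤L (^-monoˡ-≤ 4 (∣⇒≤ (rad-∣ (∏ v) P (proj₁ ∏∣) (proj₂ ∏∣)))) ⟩
    L * P ^ 4            ≤⟨ *-monoʳ-≤ L (^-monoˡ-≤ 4 (*-mono-≤ p₁≤L² p₂≤L²)) ⟩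
    L * (L ^ 2 * L ^ 2) ^ 4  ≡⟨ cong (λ x → L * x ^ 4) (^-distribˡ-+-* L 2 2) ⟨
    L * (L ^ 4) ^ 4      ≡⟨ cong (L *_) (^-*-assoc L 4 4) ⟩
    L ^ 17               <⟨ ^-monoˡ-< 17 L<p₁ ⟩
    p₁ ^ 17              ∎
    where
    open ≤-Reasoning
    ∏∣ = ∏-∣ {m = P} {k = exponent} v v∣P^k

  v≡1 : ∀ i → ∣ v i ∣ ≡ 1
  -- The bound `v<` is what dictates D = 17 in the choice of the pair.
  v≡1 = units-of-absolute-value-1 {k = exponent} {D = 17} v p₁-prime p₂-prime (≤-<-trans 4≤L L<p₁) avoids
    noSub gcd≡1 ∑v≡0 v< v∣P^k

-- Arbitrarily large pairs and the conclusion

primePair-exists : ∀ n D L₀ → 1 ≤ n → ∃[ L ] (L₀ ≤ L × PrimePair n D L)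
primePair-exists n D L₀ 1≤n =
  let L , L₀+n+2≤L , block = primeBlock-exists (suc (2 * D) ^ suc n) (L₀ + (n + 2))
      n+2≤L = ≤-trans (m≤n+m (n + 2) L₀) L₀+n+2≤L
  in L , ≤-trans (m≤m+n L₀ (n + 2)) L₀+n+2≤L
   , primePair n D L 1≤n (≤-trans (m≤m+n n 2) n+2≤L) (≤-trans (m≤n+m 2 n) n+2≤L) block

¬Has4Cycle : ∀ {C L} → ConjecturalBound C → C ≤ L → 4 ≤ L → (pair : PrimePair 4 17 L) →
  let open PrimePair pair in
  ¬ Has4Cycle (ℤ[1/ p₁ ,1/ p₂ ] {{prime⇒nonZero p₁-prime}} {{prime⇒nonZero p₂-prime}})
¬Has4Cycle bound C≤L 4≤L pair cycle =
  ¬unitEquation bound C≤L 4≤L pair (Has4Cycle⇒UnitEquation gen-den cycle)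
  where
  open PrimePair pair
  instance
    p₁-nonZero : NonZero p₁
    p₁-nonZero = prime⇒nonZero p₁-prime
    p₂-nonZero : NonZero p₂
    p₂-nonZero = prime⇒nonZero p₂-prime
    p₁*p₂-nonZero : NonZero (p₁ * p₂)
    p₁*p₂-nonZero = m*n≢0 p₁ p₂
  open Localised (p₁ * p₂)

  gen-den : ∀ {x} → x ≡ 1ℤ ℚ./ p₁ ⊎ x ≡ 1ℤ ℚ./ p₂ → ∃[ k ] Denominator k x
  gen-den (inj₁ refl) = 1 , inverse-denominator p₁ p₂ refl
  gen-den (inj₂ refl) = 1 , inverse-denominator p₂ p₁ (*-comm p₁ p₂)

theorem1p6 : BrowkinBrzezinskiConjecture →
    Infinite {A = ℕ × ℕ} (λ (p₁ , p₂) →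
    Σ (Prime p₁) λ p₁-prime → Σ (Prime p₂) λ p₂-prime →
    p₁ ≢ p₂ ×
    ¬ Has4Cycle (ℤ[1/ p₁ ,1/ p₂ ] {{prime⇒nonZero p₁-prime}} {{prime⇒nonZero p₂-prime}}))
theorem1p6 conjecture xs =
  conclude (conjecturalBound conjecture) λ C → primePair-exists 4 17 (C + (4 + M)) (s≤s z≤n)
  where
  -- The threshold C + (4 + M) secures C ≤ L and 4 ≤ L, and also M ≤ L < p₁, so that the new pair
  -- differs from every listed one in its first component.
  M = max 0 (List.map proj₁ xs)
  conclude : ∃ ConjecturalBound → (∀ C → ∃[ L ] (C + (4 + M) ≤ L × PrimePair 4 17 L)) → _
  conclude (C , bound) pairs =
    let L , L₀≤L , pair = pairs C
        open PrimePair pair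
        4+M≤L = ≤-trans (m≤n+m (4 + M) C) L₀≤L
    in (p₁ , p₂)
     , (p₁-prime , p₂-prime , p₁≢p₂ ,
         ¬Has4Cycle {C} {L} bound (≤-trans (m≤m+n C (4 + M)) L₀≤L) (≤-trans (m≤m+n 4 M) 4+M≤L) pair)
     , λ p∈xs → <⇒≱ L<p₁ (≤-trans
         (All.lookup (xs≤max 0 (List.map proj₁ xs)) (∈.∈-map⁺ proj₁ p∈xs))
         (≤-trans (m≤n+m M 4) 4+M≤L))
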